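{- Let $G=([m],E)$ be a connected undirected graph, let $P_{ii'}>0$ for $\{i,i'\}\in E$ with $\sum_{\{i,i'\}\in E}P_{ii'}=1$, and let $b_1(0),\dots,b_m(0)\in\mathbb{R}^n$ be initial score vectors whose average $\bar b=\frac1m\sum_{i=1}^m b_i(0)$ is ordered: $\bar b^1\le\bar b^2\le\cdots\le\bar b^n$. Let $T$ be the consensus time for the ordering of the gossip process described in the context. Then $$P(T>t)\le 4m\,\lambda_2^t(W)\sum_{j=1}^n\left(\frac{d^j}{r^j}\right)^2,$$ where $W=\sum_{\{i,i'\}\in E}P_{ii'}\left(I-\frac12(e_i-e_{i'})(e_i-e_{i'})^T\right)$, $e_i$ is the $m\times1$ vector with $i$th entry equal to one and all other entries zero, $\lambda_2(W)$ is the second largest eigenvalue of $W$, and $\lambda_2^t(W)=(\lambda_2(W))^t$.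
   Context: Superscripts denote coordinates (objects), subscripts denote agents: $b_i^j(t)$ is the score of agent $i\in[m]$ for object $j\in[n]$ at time $t$, where $[k]=\{1,\dots,k\}$. (For Borda's method, $b_i(0)=\sigma_i^{ -1}$, where the permutation $\sigma_i$ of $[n]$ is agent $i$'s ranking, so that $b_i^j(0)=\sigma_i^{ -1}(j)$ is the position of object $j$ in it.) Gossip process: at each time $t=0,1,2,\dots$, independently of the past, an edge $\{i,i'\}\in E$ is picked with probability $P_{ii'}$; then $b_i(t+1)=b_{i'}(t+1)=\frac12(b_i(t)+b_{i'}(t))$, and $b_\ell(t+1)=b_\ell(t)$ for $\ell\ne i,i'$. A time $t$ is a consensus time if the ordering of $b_i(t)$ matches the ordering of $\bar b$ for all $i\in[m]$, i.e. $b_i^1(t)\le b_i^2(t)\le\cdots\le b_i^n(t)$ for all $i\in[m]$. The consensus time for the ordering is $T=\min\{t\ge0: t\text{ is a consensus time}\}$. For $j\in[n]$, $r^j=\min\{\bar b^{j+1}-\bar b^j,\ \bar b^j-\bar b^{j-1}\}$, where the undefined term is omitted for $j=1$ and $j=n$, and $d^j=\max_i b_i^j(0)-\min_i b_i^j(0)$. -}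

module Defs where

open import Level using (0ℓ)
open import Algebra.Bundles using (CommutativeRing; Semiring)
import Algebra.Definitions.RawSemiring as RawSemiringDefinitions
open import Data.Bool.Base using (if_then_else_)
open import Data.Fin.Base as Fin using (Fin; zero; suc; toℕ; fromℕ<; inject₁)
import Data.Fin.Properties as Fin
import Data.List.Base as List
import Data.List.Extrema as Extrema
open import Data.Nat.Base as ℕ using (ℕ; zero; suc; NonZero)
import Data.Nat.Properties as ℕ
open import Data.Product.Base using (∃; ∃₂; _×_; _,_)
open import Data.Vec.Base using (Vec; []; _∷_)
open import Data.Vec.Functional using (Vector; foldr)
open import Relation.Binary.Bundles using (DecTotalOrder)
open import Relation.Binary.Construct.Closure.ReflexiveTransitive using (Star)
open import Relation.Binary.Core using (Rel)
open import Relation.Binary.Definitions using (Decidable; Irreflexive; Symmetric)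
open import Relation.Binary.PropositionalEquality.Core using (_≡_)
open import Relation.Binary.Structures using (IsDecTotalOrder)
open import Relation.Nullary.Construct.Add.Supremum using (_⁺; [_]; ⊤⁺)
open import Relation.Nullary.Decidable using (Dec; does; yes; no; ¬?; _×-dec_; _→-dec_; _⊎-dec_)
open import Relation.Nullary.Negation.Core using (¬_)
open import Relation.Unary using (Pred)

-- The real numbers, axiomatised classically: up to isomorphism ℝ is the
-- only Dedekind-complete ordered field.  `_⁻¹` is total, but its value at
-- 0# is unspecified.
record CompleteOrderedField : Set₁ where
  infix 4 _≤_
  infix 8 _⁻¹

  field
    commutativeRing : CommutativeRing 0ℓ 0ℓ

  open CommutativeRing commutativeRing public hiding (_≉_)

  field
    _≤_             : Rel Carrier 0ℓ
    isDecTotalOrder : IsDecTotalOrder _≈_ _≤_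
    +-monoˡ-≤       : ∀ {x y} z → x ≤ y → x + z ≤ y + z
    *-nonNegative   : ∀ {x y} → 0# ≤ x → 0# ≤ y → 0# ≤ x * y
    0≉1             : ¬ (0# ≈ 1#)
    _⁻¹             : Carrier → Carrier
    ⁻¹-inverseˡ     : ∀ {x} → ¬ (x ≈ 0#) → x ⁻¹ * x ≈ 1#

  UpperBound : Pred Carrier 0ℓ → Pred Carrier 0ℓ
  UpperBound S u = ∀ {x} → S x → x ≤ u

  field
    supremum : ∀ (S : Pred Carrier 0ℓ) → ∃ S → ∃ (UpperBound S) →
               ∃ λ s → UpperBound S s × (∀ {u} → UpperBound S u → s ≤ u)

  decTotalOrder : DecTotalOrder 0ℓ 0ℓ 0ℓ
  decTotalOrder = record { isDecTotalOrder = isDecTotalOrder }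

record Graph (m : ℕ) : Set₁ where
  field
    _~_      : Rel (Fin m) 0ℓ
    ~-dec    : Decidable _~_
    ~-sym    : Symmetric _~_
    ~-irrefl : Irreflexive _≡_ _~_

  Connected : Set
  Connected = ∀ i i′ → Star _~_ i i′

module Gossip (ℝ : CompleteOrderedField) where

  open CompleteOrderedField ℝ public
    using (Carrier; _≈_; _≤_; _+_; _*_; _-_; 0#; 1#; _⁻¹)
  open CompleteOrderedField ℝ using (semiring; decTotalOrder)
  open DecTotalOrder decTotalOrder using (totalOrder; _≤?_; _≟_)
  open import Relation.Binary.Properties.DecTotalOrder decTotalOrder public
    using (_<_)
  open import Algebra.Construct.NaturalChoice.Min totalOrder using (_⊓_)
  open RawSemiringDefinitions (Semiring.rawSemiring semiring) public
    using (sum; _^_) renaming (_×_ to _·_)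
  open import Relation.Binary.Construct.Add.Supremum.NonStrict _≤_ public
    using (_≤⁺_)

  half : Carrier
  half = (1# + 1#) ⁻¹

  indicator : ∀ {A : Set} → Dec A → Carrier
  indicator a? = if does a? then 1# else 0#

  maximum minimum : ∀ {m} .{{_ : NonZero m}} → Vector Carrier m → Carrier
  maximum {suc m} v = Extrema.max totalOrder (v zero) (List.tabulate λ i → v (suc i))
  minimum {suc m} v = Extrema.min totalOrder (v zero) (List.tabulate λ i → v (suc i))

  -- Arithmetic of [0,∞], where ⊤⁺ is ∞.  Only used on non-negative
  -- arguments.

  infixl 6 _+⁺_
  infixl 7 _÷⁺_
  infixr 7 _*⁺_

  _+⁺_ : Carrier ⁺ → Carrier ⁺ → Carrier ⁺
  [ x ] +⁺ [ y ] = [ x + y ]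
  [ _ ] +⁺ ⊤⁺    = ⊤⁺
  ⊤⁺    +⁺ _     = ⊤⁺

  sum⁺ : ∀ {n} → Vector (Carrier ⁺) n → Carrier ⁺
  sum⁺ = foldr _+⁺_ [ 0# ]

  _⊓⁺_ : Carrier ⁺ → Carrier ⁺ → Carrier ⁺
  [ x ] ⊓⁺ [ y ] = [ x ⊓ y ]
  [ x ] ⊓⁺ ⊤⁺    = [ x ]
  ⊤⁺    ⊓⁺ y     = y

  -- x / ∞ = 0,  0 / 0 = 0,  and x / 0 = ∞ for x ≠ 0.
  _÷⁺_ : Carrier → Carrier ⁺ → Carrier ⁺
  x ÷⁺ ⊤⁺    = [ 0# ]
  x ÷⁺ [ y ] = if does (y ≟ 0#)
               then (if does (x ≟ 0#) then [ 0# ] else ⊤⁺)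
               else [ x * y ⁻¹ ]

  square⁺ : Carrier ⁺ → Carrier ⁺
  square⁺ [ x ] = [ x * x ]
  square⁺ ⊤⁺    = ⊤⁺

  -- 0 * ∞ = 0,  and x * ∞ = ∞ for x > 0.
  _*⁺_ : Carrier → Carrier ⁺ → Carrier ⁺
  x *⁺ [ y ] = [ x * y ]
  x *⁺ ⊤⁺    = if does (x ≤? 0#) then [ 0# ] else ⊤⁺

  Matrix : ℕ → Set
  Matrix m = Fin m → Fin m → Carrier

  δ : ∀ {m} → Matrix m
  δ k l = indicator (k Fin.≟ l)

  Eigenvector : ∀ {m} → Matrix m → Carrier → Vector Carrier m → Set
  Eigenvector A μ v =
    (∃ λ k → ¬ (v k ≈ 0#)) × (∀ k → sum (λ l → A k l * v l) ≈ μ * v k)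

  Eigenvalue : ∀ {m} → Matrix m → Carrier → Set
  Eigenvalue A μ = ∃ (Eigenvector A μ)

  LinearlyIndependent : ∀ {m k} → Vector (Vector Carrier m) k → Set
  LinearlyIndependent {k = k} v =
    ∀ (c : Vector Carrier k) →
    (∀ l → sum (λ a → c a * v a l) ≈ 0#) → ∀ a → c a ≈ 0#

  -- At least k eigenvalues of A, counted with multiplicity, satisfy Q.
  -- Multiplicity is geometric, which for a symmetric A is the same as
  -- algebraic.
  AtLeastEigenvalues : ∀ {m} → ℕ → Matrix m → Pred Carrier 0ℓ → Set
  AtLeastEigenvalues {m} k A Q =
    ∃₂ λ (μ : Vector Carrier k) (v : Vector (Vector Carrier m) k) →
    LinearlyIndependent v ×
    (∀ a → Eigenvector A (μ a) (v a)) ×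
    (∀ a → Q (μ a))

  -- λₖ is the k-th entry of the list λ₁ ≥ λ₂ ≥ … of eigenvalues of A,
  -- repeated according to multiplicity (k ≥ 1).
  IsKthLargestEigenvalue : ∀ {m} → ℕ → Matrix m → Carrier → Set
  IsKthLargestEigenvalue k A λₖ =
    Eigenvalue A λₖ ×
    AtLeastEigenvalues k A (λₖ ≤_) ×
    ¬ AtLeastEigenvalues k A (λₖ <_)

  -- Each edge {i,i′} is counted once, as the pair with i < i′.
  sumEdges : ∀ {m} → Graph m → (Fin m → Fin m → Carrier) → Carrier
  sumEdges G f = sum λ i → sum λ i′ →
    if does ((i Fin.<? i′) ×-dec Graph.~-dec G i i′) then f i i′ else 0#

  record IsEdgeDistribution {m} (G : Graph m) (P : Fin m → Fin m → Carrier) : Set where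
    open Graph G
    field
      symmetric : ∀ {i i′} → i ~ i′ → P i i′ ≈ P i′ i
      positive  : ∀ {i i′} → i ~ i′ → 0# < P i i′
      total     : sumEdges G P ≈ 1#

  gossipMatrix : ∀ {m} → Graph m → (Fin m → Fin m → Carrier) → Matrix m
  gossipMatrix G P k l = sumEdges G λ i i′ →
    P i i′ * (δ k l - half * ((δ i k - δ i′ k) * (δ i l - δ i′ l)))

  -- b i j is the score of agent i for object j.

  Scores : ℕ → ℕ → Set
  Scores m n = Fin m → Fin n → Carrier

  average : ∀ {m n} → Scores m n → Vector Carrier n
  average {m} b j = (m · 1#) ⁻¹ * sum (λ i → b i j)

  Ordered : ∀ {n} → Vector Carrier n → Set
  Ordered {n} v = ∀ (j k : Fin n) → j Fin.≤ k → v j ≤ v k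

  Consensus : ∀ {m n} → Scores m n → Set
  Consensus b = ∀ i → Ordered (b i)

  spread : ∀ {m n} .{{_ : NonZero m}} → Scores m n → Fin n → Carrier
  spread b j = maximum (λ i → b i j) - minimum (λ i → b i j)

  -- The gaps to the neighbours in v; an omitted term of a minimum is ∞.
  gapAbove gapBelow : ∀ {n} → Vector Carrier n → Fin n → Carrier ⁺
  gapAbove {n} v j with suc (toℕ j) ℕ.<? n
  ... | yes j+1<n = [ v (fromℕ< j+1<n) - v j ]
  ... | no  _     = ⊤⁺
  gapBelow v zero    = ⊤⁺
  gapBelow v (suc j) = [ v (suc j) - v (inject₁ j) ]

  separation : ∀ {n} → Vector Carrier n → Fin n → Carrier ⁺
  separation v j = gapAbove v j ⊓⁺ gapBelow v j

  step : ∀ {m n} → Fin m × Fin m → Scores m n → Scores m n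
  step (i , i′) b l j =
    if does ((l Fin.≟ i) ⊎-dec (l Fin.≟ i′)) then half * (b i j + b i′ j) else b l j

  -- The scores at times 0, …, t when b is the initial state and edges
  -- lists the edges picked at times 0, …, t - 1.
  scoresAt : ∀ {m n t} → Scores m n → Vec (Fin m × Fin m) t → Fin (suc t) → Scores m n
  scoresAt b edges       zero    = b
  scoresAt b (e ∷ edges) (suc s) = scoresAt (step e b) edges s

  -- The event T > t, for T the least consensus time in ℕ ∪ {∞}.  It is
  -- determined by the edges picked at times 0, …, t - 1.
  T>t : ∀ {m n t} → Scores m n → Vec (Fin m × Fin m) t → Set
  T>t b edges = ∀ s → ¬ Consensus (scoresAt b edges s)

  consensus? : ∀ {m n} (b : Scores m n) → Dec (Consensus b)
  consensus? b = Fin.all? λ i → Fin.all? λ j → Fin.all? λ k →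
    (j Fin.≤? k) →-dec (b i j ≤? b i k)

  T>t? : ∀ {m n t} (b : Scores m n) (edges : Vec (Fin m × Fin m) t) → Dec (T>t b edges)
  T>t? b edges = Fin.all? λ s → ¬? (consensus? (scoresAt b edges s))

  -- Expectation over t edges picked independently from the distribution P.
  expectation : ∀ {m} → Graph m → (Fin m → Fin m → Carrier) →
                ∀ t → (Vec (Fin m × Fin m) t → Carrier) → Carrier
  expectation G P zero    f = f []
  expectation G P (suc t) f = sumEdges G λ i i′ →
    P i i′ * expectation G P t (λ edges → f ((i , i′) ∷ edges))

  probability[T>_] : ∀ {m n} → ℕ → Graph m → (Fin m → Fin m → Carrier) → Scores m n → Carrier
  probability[T> t ] G P b = expectation G P t (λ edges → indicator (T>t? b edges))

module Submission where

-- A gossip step along {i,i′} is an orthogonal projection fixing the constant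
-- vectors, so for each object the expected energy Σᵢ (bᵢʲ − b̄ʲ)² after a step
-- is the quadratic form of W at the vector of deviations.  This vector sums
-- to 0, where W is at most λ₂, so the expected energy at time t is at most
-- λ₂ᵗ times the initial one, which is at most m (dʲ)².  If t is not a consensus
-- time then 4 Σᵢ (bᵢʲ − b̄ʲ)² > (rʲ)² for some object j, and Markov's inequality
-- with a union bound over j gives the claim.
--
-- That W ≤ λ₂ on the vectors of sum 0 needs an eigenvector there for the
-- supremum μ of the Rayleigh quotient.  No compactness is used: a quadratic
-- form over an ordered field is either coercive or nonpositive at some x ≠ 0
-- (complete squares, by induction on the dimension); μ I − A is not coercive
-- because μ is the least upper bound, and a zero of a positive semidefinite
-- form lies in its kernel.

open import Defs
open import Algebra.Bundles using (CommutativeRing)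
open import Algebra.Solver.Ring.AlmostCommutativeRing
  using (fromCommutativeRing; _-Raw-AlmostCommutative⟶_; Induced-equivalence)
open import Data.Bool.Base using (if_then_else_)
open import Data.Empty using (⊥)
open import Data.Fin.Base as Fin using (Fin; zero; suc; fromℕ; inject₁; toℕ)
import Data.Fin.Properties as Fin
open import Data.Integer.Base as ℤ using (ℤ; +_; -[1+_]; _⊖_)
import Data.Integer.Properties as ℤ
import Data.List.Base as List
import Data.List.Extrema as Extrema
open import Data.List.Relation.Unary.All.Properties using (tabulate⁻)
import Data.Maybe.Base as Maybe
open import Data.Nat.Base as ℕ using (ℕ; zero; suc; NonZero)
import Data.Nat.Properties as ℕ
open import Data.Product.Base using (∃; ∃₂; _×_; _,_; proj₁; proj₂)
open import Data.Sum.Base using (_⊎_; inj₁; inj₂)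
open import Data.Vec.Base as Vec using (Vec)
open import Data.Vec.Functional using (Vector; _∷_; tail; [])
open import Relation.Binary.Bundles using (DecTotalOrder)
open import Relation.Binary.Definitions using (WeaklyDecidable)
open import Relation.Binary.PropositionalEquality.Core as ≡ using (_≢_)
open import Relation.Nullary.Construct.Add.Supremum using (_⁺; [_]; ⊤⁺)
open import Relation.Nullary.Decidable using (Dec; does; yes; no; ¬?; _×-dec_; decidable-stable; dec⇒maybe)
open import Relation.Nullary.Negation.Core using (¬_; contradiction)

-- The factor 4 is the square of 2: the scores of objects j < k stay in order while each is off by
-- at most half of b̄ᵏ - b̄ʲ in the harmful direction, and that gap is at least rʲ and at least rᵏ.
--
-- `λ₂` is given only by counting independent eigenvectors, so the bound on vectors of sum 0 is
-- proved by contradiction. A violation yields an eigenvector of sum 0 with eigenvalue above `λ₂`;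
-- if `λ₂ < 1#`, the constant vectors, of eigenvalue 1, are a second one, which is one too many. If
-- `1# ≤ λ₂`, the plain bound W ≤ 1 is enough.
--
-- The right-hand side lives in [0,∞]. Its conventions 0 / 0 = 0 and 0 * ∞ = 0 assert probability
-- zero in cases where rʲ = 0, and there no multiple of the energy dominates the indicator, so
-- Markov's inequality is silent. In these cases the expected energy is 0, and because every edge
-- has positive probability the energy is 0 after every sequence of edges that can be picked.

module IntegerSolver {c ℓ} (R : CommutativeRing c ℓ) where

  -- A ring solver with integer coefficients.

  open CommutativeRing R
  open import Algebra.Properties.Ring ring
    using (-0#≈0#; -‿involutive; -‿distribˡ-*; -‿distribʳ-*; -‿+-comm)
  open import Algebra.Properties.CommutativeSemigroup +-commutativeSemigroup using (interchange)
  open import Algebra.Properties.Semiring.Mult semiring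
    using (×-homo-+; ×1-homo-*) renaming (_×_ to _·_)
  open import Relation.Binary.Reasoning.Setoid setoid

  -- The case distinction at 0 and 1 makes the constants 0 and 1 of the
  -- solver denote 0# and 1# definitionally.
  ⟦_⟧ : ℤ → Carrier
  ⟦ + 0           ⟧ = 0#
  ⟦ + 1           ⟧ = 1#
  ⟦ + suc (suc n) ⟧ = suc (suc n) · 1#
  ⟦ -[1+ n ]      ⟧ = - (suc n · 1#)

  ⟦+⟧ : ∀ n → ⟦ + n ⟧ ≈ n · 1#
  ⟦+⟧ 0             = refl
  ⟦+⟧ 1             = sym (+-identityʳ 1#)
  ⟦+⟧ (suc (suc n)) = refl

  ⊖-homo : ∀ m n → ⟦ m ⊖ n ⟧ ≈ m · 1# - n · 1#
  ⊖-homo m       zero    = trans (⟦+⟧ m) (trans (sym (+-identityʳ _)) (+-congˡ (sym -0#≈0#)))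
  ⊖-homo zero    (suc n) = sym (+-identityˡ _)
  ⊖-homo (suc m) (suc n) = begin
    ⟦ suc m ⊖ suc n ⟧                 ≡⟨ ≡.cong ⟦_⟧ (ℤ.[1+m]⊖[1+n]≡m⊖n m n) ⟩
    ⟦ m ⊖ n ⟧                         ≈⟨ ⊖-homo m n ⟩
    m · 1# - n · 1#                   ≈⟨ +-identityˡ _ ⟨
    0# + (m · 1# - n · 1#)            ≈⟨ +-congʳ (-‿inverseʳ 1#) ⟨
    1# - 1# + (m · 1# - n · 1#)       ≈⟨ interchange _ _ _ _ ⟩
    suc m · 1# + (- 1# - n · 1#)      ≈⟨ +-congˡ (-‿+-comm _ _) ⟩
    suc m · 1# - suc n · 1#           ∎

  +-homo : ∀ i j → ⟦ i ℤ.+ j ⟧ ≈ ⟦ i ⟧ + ⟦ j ⟧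
  +-homo (+ m)    (+ n)    = trans (⟦+⟧ (m ℕ.+ n))
    (trans (×-homo-+ 1# m n) (sym (+-cong (⟦+⟧ m) (⟦+⟧ n))))
  +-homo (+ m)    -[1+ n ] = trans (⊖-homo m (suc n)) (+-congʳ (sym (⟦+⟧ m)))
  +-homo -[1+ m ] (+ n)    = trans (⊖-homo n (suc m)) (trans (+-congʳ (sym (⟦+⟧ n))) (+-comm _ _))
  +-homo -[1+ m ] -[1+ n ] = begin
    - (suc (suc (m ℕ.+ n)) · 1#)      ≡⟨ ≡.cong (λ k → - (k · 1#)) (ℕ.+-suc (suc m) n) ⟨
    - ((suc m ℕ.+ suc n) · 1#)        ≈⟨ -‿cong (×-homo-+ 1# (suc m) (suc n)) ⟩
    - (suc m · 1# + suc n · 1#)       ≈⟨ -‿+-comm _ _ ⟨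
    - (suc m · 1#) - suc n · 1#       ∎

  -‿homo : ∀ i → ⟦ ℤ.- i ⟧ ≈ - ⟦ i ⟧
  -‿homo (+ 0)     = sym -0#≈0#
  -‿homo (+ suc n) = -‿cong (sym (⟦+⟧ (suc n)))
  -‿homo -[1+ n ]  = trans (⟦+⟧ (suc n)) (sym (-‿involutive _))

  *-homo⁺ : ∀ m j → ⟦ + m ℤ.* j ⟧ ≈ ⟦ + m ⟧ * ⟦ j ⟧
  *-homo⁺ m (+ n) = begin
    ⟦ + m ℤ.* + n ⟧         ≡⟨ ≡.cong ⟦_⟧ (ℤ.pos-* m n) ⟨
    ⟦ + (m ℕ.* n) ⟧         ≈⟨ ⟦+⟧ (m ℕ.* n) ⟩
    (m ℕ.* n) · 1#          ≈⟨ ×1-homo-* m n ⟩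
    m · 1# * n · 1#         ≈⟨ *-cong (⟦+⟧ m) (⟦+⟧ n) ⟨
    ⟦ + m ⟧ * ⟦ + n ⟧       ∎
  *-homo⁺ m -[1+ n ] = begin
    ⟦ + m ℤ.* -[1+ n ] ⟧     ≡⟨ ≡.cong ⟦_⟧ (ℤ.neg-distribʳ-* (+ m) (+ suc n)) ⟨
    ⟦ ℤ.- (+ m ℤ.* + suc n) ⟧ ≈⟨ -‿homo (+ m ℤ.* + suc n) ⟩
    - ⟦ + m ℤ.* + suc n ⟧    ≈⟨ -‿cong (*-homo⁺ m (+ suc n)) ⟩
    - (⟦ + m ⟧ * ⟦ + suc n ⟧) ≈⟨ -‿distribʳ-* _ _ ⟩
    ⟦ + m ⟧ * - ⟦ + suc n ⟧  ≈⟨ *-congˡ (-‿homo (+ suc n)) ⟨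
    ⟦ + m ⟧ * ⟦ -[1+ n ] ⟧   ∎

  *-homo : ∀ i j → ⟦ i ℤ.* j ⟧ ≈ ⟦ i ⟧ * ⟦ j ⟧
  *-homo (+ m)    j = *-homo⁺ m j
  *-homo -[1+ m ] j = begin
    ⟦ -[1+ m ] ℤ.* j ⟧       ≡⟨ ≡.cong ⟦_⟧ (ℤ.neg-distribˡ-* (+ suc m) j) ⟨
    ⟦ ℤ.- (+ suc m ℤ.* j) ⟧  ≈⟨ -‿homo (+ suc m ℤ.* j) ⟩
    - ⟦ + suc m ℤ.* j ⟧      ≈⟨ -‿cong (*-homo⁺ (suc m) j) ⟩
    - (⟦ + suc m ⟧ * ⟦ j ⟧)  ≈⟨ -‿distribˡ-* _ _ ⟩
    - ⟦ + suc m ⟧ * ⟦ j ⟧    ≈⟨ *-congʳ (-‿homo (+ suc m)) ⟨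
    ⟦ -[1+ m ] ⟧ * ⟦ j ⟧     ∎

  morphism : ℤ.+-*-rawRing -Raw-AlmostCommutative⟶ fromCommutativeRing R
  morphism = record
    { ⟦_⟧    = ⟦_⟧
    ; +-homo = +-homo
    ; *-homo = *-homo
    ; -‿homo = -‿homo
    ; 0-homo = refl
    ; 1-homo = refl
    }

  -- Coefficients are compared in ℤ, where equality evaluates, so the normaliser can drop terms that
  -- cancel; equality in an abstract ring would not reduce.
  _coeff≟_ : WeaklyDecidable (Induced-equivalence morphism)
  i coeff≟ j = Maybe.map (λ i≡j → reflexive (≡.cong ⟦_⟧ i≡j)) (dec⇒maybe (i ℤ.≟ j))

  open import Algebra.Solver.Ring ℤ.+-*-rawRing (fromCommutativeRing R) morphism _coeff≟_ public
    using (solve; con; _:=_; _:+_; _:*_; _:-_; :-_)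

-- Ordered field arithmetic and finite sums.

module OrderedField (ℝ : CompleteOrderedField) where

  open Gossip ℝ public
  open CompleteOrderedField ℝ public
    using ( commutativeRing; +-monoˡ-≤; *-nonNegative; 0≉1; ⁻¹-inverseˡ; supremum; decTotalOrder
          ; -_; semiring; +-cong; +-congˡ; +-congʳ; *-cong; *-congˡ; *-congʳ; -‿cong
          ; +-identityˡ; +-identityʳ; *-identityˡ; *-identityʳ; *-comm; +-comm; *-assoc
          ; zeroˡ; zeroʳ; distribˡ; distribʳ; -‿inverseʳ )
    renaming (refl to ≈-refl; sym to ≈-sym; trans to ≈-trans; reflexive to ≈-reflexive)
  open DecTotalOrder decTotalOrder public
    using (totalOrder; _≟_; _≤?_; poset)
    renaming (refl to ≤-refl; trans to ≤-trans; antisym to ≤-antisym; reflexive to ≤-reflexive; total to ≤-total)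
  open import Relation.Binary.Properties.DecTotalOrder decTotalOrder public
    using (≰⇒>; <⇒≱; ≮⇒≥)
  open import Algebra.Properties.Semiring.Sum semiring public
    using (sum-cong-≋; sum-replicate-zero; ∑-distrib-+; ∑-comm; *-distribˡ-sum)
  open IntegerSolver commutativeRing public using (solve; con; _:=_; _:+_; _:*_; _:-_; :-_)
  module ≤-Reasoning where
    open import Relation.Binary.Reasoning.PartialOrder poset public
  open ≤-Reasoning

  -- The standard way to an inequality below: the difference is named as a sum of visibly
  -- nonnegative terms, and the identity `x + e ≈ y` is left to the solver.
  0≤⇒≤ : ∀ {x y e} → 0# ≤ e → x + e ≈ y → x ≤ y
  0≤⇒≤ {x} {y} {e} 0≤e x+e≈y = begin
    x      ≈⟨ +-identityˡ x ⟨
    0# + x ≤⟨ +-monoˡ-≤ x 0≤e ⟩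
    e + x  ≈⟨ +-comm e x ⟩
    x + e  ≈⟨ x+e≈y ⟩
    y      ∎

  ≤⇒0≤ : ∀ {x y} → x ≤ y → 0# ≤ y - x
  ≤⇒0≤ {x} {y} x≤y = begin
    0#    ≈⟨ -‿inverseʳ x ⟨
    x - x ≤⟨ +-monoˡ-≤ (- x) x≤y ⟩
    y - x ∎

  +-mono-≤ : ∀ {x y u v} → x ≤ y → u ≤ v → x + u ≤ y + v
  +-mono-≤ {x} {y} {u} {v} x≤y u≤v = begin
    x + u ≤⟨ +-monoˡ-≤ u x≤y ⟩
    y + u ≈⟨ +-comm y u ⟩
    u + y ≤⟨ +-monoˡ-≤ y u≤v ⟩
    v + y ≈⟨ +-comm v y ⟩
    y + v ∎

  +-nonNegative : ∀ {x y} → 0# ≤ x → 0# ≤ y → 0# ≤ x + y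
  +-nonNegative 0≤x 0≤y = ≤-trans 0≤x (0≤⇒≤ 0≤y ≈-refl)

  *-monoˡ-≤ : ∀ {x y z} → 0# ≤ z → x ≤ y → z * x ≤ z * y
  *-monoˡ-≤ {x} {y} {z} 0≤z x≤y = 0≤⇒≤ (*-nonNegative 0≤z (≤⇒0≤ x≤y))
    (solve 3 (λ x y z → z :* x :+ z :* (y :- x) := z :* y) ≈-refl x y z)

  ≤0⇒0≤- : ∀ {x} → x ≤ 0# → 0# ≤ - x
  ≤0⇒0≤- {x} x≤0 = ≤-trans (≤⇒0≤ x≤0) (≤-reflexive (+-identityˡ (- x)))

  0≤x² : ∀ x → 0# ≤ x * x
  0≤x² x with ≤-total 0# x
  ... | inj₁ 0≤x = *-nonNegative 0≤x 0≤x
  ... | inj₂ x≤0 = ≤-trans (*-nonNegative (≤0⇒0≤- x≤0) (≤0⇒0≤- x≤0))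
    (≤-reflexive (solve 1 (λ x → (:- x) :* (:- x) := x :* x) ≈-refl x))

  0≤1 : 0# ≤ 1#
  0≤1 = ≤-trans (0≤x² 1#) (≤-reflexive (*-identityˡ 1#))

  0<1 : 0# < 1#
  0<1 = 0≤1 , 0≉1

  ≤-<-trans : ∀ {x y z} → x ≤ y → y < z → x < z
  ≤-<-trans x≤y (y≤z , y≉z) = ≤-trans x≤y y≤z ,
    λ x≈z → y≉z (≤-antisym y≤z (≤-trans (≤-reflexive (≈-sym x≈z)) x≤y))

  <-≤-trans : ∀ {x y z} → x < y → y ≤ z → x < z
  <-≤-trans (x≤y , x≉y) y≤z = ≤-trans x≤y y≤z ,
    λ x≈z → x≉y (≤-antisym x≤y (≤-trans y≤z (≤-reflexive (≈-sym x≈z))))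

  >⇒≉ : ∀ {x} → 0# < x → ¬ (x ≈ 0#)
  >⇒≉ (_ , 0≉x) x≈0 = 0≉x (≈-sym x≈0)

  ⁻¹-inverseʳ : ∀ {x} → ¬ (x ≈ 0#) → x * x ⁻¹ ≈ 1#
  ⁻¹-inverseʳ x≉0 = ≈-trans (*-comm _ _) (⁻¹-inverseˡ x≉0)

  x*y≈0⇒y≈0 : ∀ {x y} → ¬ (x ≈ 0#) → x * y ≈ 0# → y ≈ 0#
  x*y≈0⇒y≈0 {x} {y} x≉0 xy≈0 = begin-equality
    y              ≈⟨ *-identityˡ y ⟨
    1# * y         ≈⟨ *-congʳ (⁻¹-inverseˡ x≉0) ⟨
    x ⁻¹ * x * y   ≈⟨ *-assoc _ _ _ ⟩
    x ⁻¹ * (x * y) ≈⟨ *-congˡ xy≈0 ⟩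
    x ⁻¹ * 0#      ≈⟨ zeroʳ _ ⟩
    0#             ∎

  -- The inverse is `x` times the square of the inverse, a product of nonnegative factors.
  0≤⁻¹ : ∀ {x} → 0# < x → 0# ≤ x ⁻¹
  0≤⁻¹ {x} 0<x = begin
    0#                 ≤⟨ *-nonNegative (proj₁ 0<x) (0≤x² (x ⁻¹)) ⟩
    x * (x ⁻¹ * x ⁻¹)  ≈⟨ *-assoc _ _ _ ⟨
    x * x ⁻¹ * x ⁻¹    ≈⟨ *-congʳ (⁻¹-inverseʳ (>⇒≉ 0<x)) ⟩
    1# * x ⁻¹          ≈⟨ *-identityˡ _ ⟩
    x ⁻¹               ∎

  *-cancelˡ-≤ : ∀ {x y z} → 0# < z → z * x ≤ z * y → x ≤ y
  *-cancelˡ-≤ {x} {y} {z} 0<z zx≤zy = begin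
    x              ≈⟨ cancel x ⟨
    z ⁻¹ * (z * x) ≤⟨ *-monoˡ-≤ (0≤⁻¹ 0<z) zx≤zy ⟩
    z ⁻¹ * (z * y) ≈⟨ cancel y ⟩
    y              ∎
    where
    cancel : ∀ u → z ⁻¹ * (z * u) ≈ u
    cancel u = ≈-trans (≈-sym (*-assoc _ _ _))
                       (≈-trans (*-congʳ (⁻¹-inverseˡ (>⇒≉ 0<z))) (*-identityˡ u))

  x²≤0⇒x≈0 : ∀ {x} → x * x ≤ 0# → x ≈ 0#
  x²≤0⇒x≈0 {x} x²≤0 with x ≟ 0#
  ... | yes x≈0 = x≈0
  ... | no  x≉0 = x*y≈0⇒y≈0 x≉0 (≤-antisym x²≤0 (0≤x² x))

  0<x² : ∀ {x} → ¬ (x ≈ 0#) → 0# < x * x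
  0<x² x≉0 = ≰⇒> λ x²≤0 → x≉0 (x²≤0⇒x≈0 x²≤0)

  x²≤y²⇒x≤y : ∀ {x y} → 0# ≤ y → x * x ≤ y * y → x ≤ y
  x²≤y²⇒x≤y {x} {y} 0≤y x²≤y² with ≤-total x y
  ... | inj₁ x≤y = x≤y
  ... | inj₂ y≤x = ≤-reflexive (≈-trans
    (≈-sym (solve 2 (λ x y → y :+ (x :- y) := x) ≈-refl x y))
    (≈-trans (+-congˡ (x²≤0⇒x≈0 [x-y]²≤0)) (+-identityʳ y)))
    where
    -- If y ≤ x, then (x - y)², y² - x² and 2y(x - y) add up to 0 and the last two are nonnegative,
    -- which forces x = y.
    [x-y]²≤0 : (x - y) * (x - y) ≤ 0#
    [x-y]²≤0 = 0≤⇒≤ (+-nonNegative (≤⇒0≤ x²≤y²) (+-nonNegative p p))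
      (solve 2 (λ x y → (x :- y) :* (x :- y) :+ (y :* y :- x :* x :+ (y :* (x :- y) :+ y :* (x :- y)))
          := con (+ 0)) ≈-refl x y)
      where p = *-nonNegative 0≤y (≤⇒0≤ y≤x)

  0<1+1 : 0# < 1# + 1#
  0<1+1 = <-≤-trans 0<1 (0≤⇒≤ 0≤1 ≈-refl)

  0≤half : 0# ≤ half
  0≤half = 0≤⁻¹ 0<1+1

  half+half≈1 : half + half ≈ 1#
  half+half≈1 = begin-equality
    half + half        ≈⟨ +-cong (*-identityʳ half) (*-identityʳ half) ⟨
    half * 1# + half * 1# ≈⟨ distribˡ half 1# 1# ⟨
    half * (1# + 1#)   ≈⟨ ⁻¹-inverseˡ (>⇒≉ 0<1+1) ⟩
    1#                 ∎

  0≤· : ∀ n {x} → 0# ≤ x → 0# ≤ n · x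
  0≤· zero    0≤x = ≤-refl
  0≤· (suc n) 0≤x = +-nonNegative 0≤x (0≤· n 0≤x)

  0<n·1 : ∀ n .{{_ : NonZero n}} → 0# < n · 1#
  0<n·1 (suc n) = <-≤-trans 0<1 (0≤⇒≤ (0≤· n 0≤1) ≈-refl)

  0≤^ : ∀ {x} → 0# ≤ x → ∀ n → 0# ≤ x ^ n
  0≤^ 0≤x zero    = 0≤1
  0≤^ 0≤x (suc n) = *-nonNegative 0≤x (0≤^ 0≤x n)

  sum-cong : ∀ {n} {f g : Vector Carrier n} → (∀ k → f k ≈ g k) → sum f ≈ sum g
  sum-cong = sum-cong-≋

  sum-mono-≤ : ∀ {n} {f g : Vector Carrier n} → (∀ k → f k ≤ g k) → sum f ≤ sum g
  sum-mono-≤ {zero}  f≤g = ≤-refl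
  sum-mono-≤ {suc n} f≤g = +-mono-≤ (f≤g zero) (sum-mono-≤ λ k → f≤g (suc k))

  sum-zero : ∀ {n} {f : Vector Carrier n} → (∀ k → f k ≈ 0#) → sum f ≈ 0#
  sum-zero {n} f≈0 = ≈-trans (sum-cong f≈0) (sum-replicate-zero n)

  sum-nonNegative : ∀ {n} {f : Vector Carrier n} → (∀ k → 0# ≤ f k) → 0# ≤ sum f
  sum-nonNegative {n} 0≤f = ≤-trans (≤-reflexive (≈-sym (sum-replicate-zero n))) (sum-mono-≤ 0≤f)

  term≤sum : ∀ {n} {f : Vector Carrier n} → (∀ k → 0# ≤ f k) → ∀ k → f k ≤ sum f
  term≤sum {suc n} 0≤f zero    = 0≤⇒≤ (sum-nonNegative λ k → 0≤f (suc k)) ≈-refl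
  term≤sum {suc n} 0≤f (suc k) = ≤-trans (term≤sum (λ l → 0≤f (suc l)) k)
    (0≤⇒≤ (0≤f zero) (+-comm _ _))

  sum-linear : ∀ {n} a (f : Vector Carrier n) b g →
               sum (λ k → a * f k + b * g k) ≈ a * sum f + b * sum g
  sum-linear a f b g = ≈-trans (∑-distrib-+ (λ k → a * f k) (λ k → b * g k))
    (≈-sym (+-cong (*-distribˡ-sum a f) (*-distribˡ-sum b g)))

  sum-constant : ∀ n x → sum {n} (λ _ → x) ≈ n · 1# * x
  sum-constant zero    x = ≈-sym (zeroˡ x)
  sum-constant (suc n) x = begin-equality
    x + sum {n} (λ _ → x)   ≈⟨ +-cong (≈-sym (*-identityˡ x)) (sum-constant n x) ⟩
    1# * x + n · 1# * x     ≈⟨ distribʳ x 1# (n · 1#) ⟨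
    (1# + n · 1#) * x       ∎

  sum-δ : ∀ {n} i (f : Vector Carrier n) → sum (λ k → δ i k * f k) ≈ f i
  sum-δ {suc n} zero    f = ≈-trans (+-cong (*-identityˡ _) (sum-zero λ k → zeroˡ (f (suc k)))) (+-identityʳ _)
  sum-δ {suc n} (suc i) f = ≈-trans (+-cong (zeroˡ _) (sum-δ i λ k → f (suc k))) (+-identityˡ _)

  δ-sym : ∀ {n} (k l : Fin n) → δ k l ≈ δ l k
  δ-sym zero    zero    = ≈-refl
  δ-sym zero    (suc l) = ≈-refl
  δ-sym (suc k) zero    = ≈-refl
  δ-sym (suc k) (suc l) = δ-sym k l

  half+half-1≈0 : half + half - 1# ≈ 0#
  half+half-1≈0 = ≈-trans (+-congʳ half+half≈1) (-‿inverseʳ 1#)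

  1≤n·1 : ∀ n .{{_ : NonZero n}} → 1# ≤ n · 1#
  1≤n·1 (suc n) = 0≤⇒≤ (0≤· n 0≤1) ≈-refl

-- Quadratic forms and an eigenvector for the supremum of the Rayleigh quotient.

module QuadraticForms (ℝ : CompleteOrderedField) where

  open OrderedField ℝ
  open ≤-Reasoning

  infix 9 ∥_∥²
  infixr 8 _▹_

  ⟨_,_⟩ : ∀ {m} → Vector Carrier m → Vector Carrier m → Carrier
  ⟨ x , y ⟩ = sum λ k → x k * y k

  ∥_∥² : ∀ {m} → Vector Carrier m → Carrier
  ∥ x ∥² = ⟨ x , x ⟩

  _▹_ : ∀ {m} → Matrix m → Vector Carrier m → Vector Carrier m
  (A ▹ x) k = sum λ l → A k l * x l

  quadratic : ∀ {m} → Matrix m → Vector Carrier m → Carrier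
  quadratic A x = ⟨ x , A ▹ x ⟩

  ⟨⟩-cong : ∀ {m} {x x′ y y′ : Vector Carrier m} →
            (∀ k → x k ≈ x′ k) → (∀ k → y k ≈ y′ k) → ⟨ x , y ⟩ ≈ ⟨ x′ , y′ ⟩
  ⟨⟩-cong x≈x′ y≈y′ = sum-cong λ k → *-cong (x≈x′ k) (y≈y′ k)

  ⟨⟩-comm : ∀ {m} (x y : Vector Carrier m) → ⟨ x , y ⟩ ≈ ⟨ y , x ⟩
  ⟨⟩-comm x y = sum-cong λ k → *-comm (x k) (y k)

  ⟨⟩-linearʳ : ∀ {m} (x : Vector Carrier m) a y b z →
               ⟨ x , (λ k → a * y k + b * z k) ⟩ ≈ a * ⟨ x , y ⟩ + b * ⟨ x , z ⟩
  ⟨⟩-linearʳ x a y b z = ≈-trans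
    (sum-cong λ k → solve 5 (λ x a y b z → x :* (a :* y :+ b :* z) := a :* (x :* y) :+ b :* (x :* z))
                            ≈-refl (x k) a (y k) b (z k))
    (sum-linear a (λ k → x k * y k) b (λ k → x k * z k))

  ⟨⟩-linearˡ : ∀ {m} a (x : Vector Carrier m) b y z →
               ⟨ (λ k → a * x k + b * y k) , z ⟩ ≈ a * ⟨ x , z ⟩ + b * ⟨ y , z ⟩
  ⟨⟩-linearˡ a x b y z = ≈-trans (⟨⟩-comm _ z) (≈-trans (⟨⟩-linearʳ z a x b y)
    (+-cong (*-congˡ (⟨⟩-comm z x)) (*-congˡ (⟨⟩-comm z y))))

  0≤∥∥² : ∀ {m} (x : Vector Carrier m) → 0# ≤ ∥ x ∥²
  0≤∥∥² x = sum-nonNegative λ k → 0≤x² (x k)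

  ∥∥²≤0⇒≈0 : ∀ {m} {x : Vector Carrier m} → ∥ x ∥² ≤ 0# → ∀ k → x k ≈ 0#
  ∥∥²≤0⇒≈0 {x = x} ∥x∥²≤0 k = x²≤0⇒x≈0 (≤-trans (term≤sum (λ l → 0≤x² (x l)) k) ∥x∥²≤0)

  ∥∥²≈0⊎0<∥∥² : ∀ {m} (x : Vector Carrier m) → ∥ x ∥² ≈ 0# ⊎ 0# < ∥ x ∥²
  ∥∥²≈0⊎0<∥∥² x with ∥ x ∥² ≤? 0#
  ... | yes ∥x∥²≤0 = inj₁ (≤-antisym ∥x∥²≤0 (0≤∥∥² x))
  ... | no  ∥x∥²≰0 = inj₂ (≰⇒> ∥x∥²≰0)

  ▹-linear : ∀ {m} (A : Matrix m) a x b y k →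
             (A ▹ λ l → a * x l + b * y l) k ≈ a * (A ▹ x) k + b * (A ▹ y) k
  ▹-linear A a x b y k = ⟨⟩-linearʳ (A k) a x b y

  ▹-comm : ∀ {m} {A : Matrix m} → (∀ k l → A k l ≈ A l k) → ∀ x y → ⟨ x , A ▹ y ⟩ ≈ ⟨ y , A ▹ x ⟩
  ▹-comm {A = A} A-sym x y = begin-equality
    (sum λ k → x k * sum λ l → A k l * y l)   ≈⟨ sum-cong (λ k → *-distribˡ-sum (x k) (λ l → A k l * y l)) ⟩
    (sum λ k → sum λ l → x k * (A k l * y l)) ≈⟨ ∑-comm (λ k l → x k * (A k l * y l)) ⟩
    (sum λ l → sum λ k → x k * (A k l * y l)) ≈⟨ sum-cong (λ l → sum-cong λ k → ≈-trans
        (solve 3 (λ x a y → x :* (a :* y) := y :* (a :* x)) ≈-refl (x k) (A k l) (y l))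
        (*-congˡ (*-congʳ (A-sym k l)))) ⟩
    (sum λ l → sum λ k → y l * (A l k * x k)) ≈⟨ sum-cong (λ l → *-distribˡ-sum (y l) (λ k → A l k * x k)) ⟨
    (sum λ l → y l * sum λ k → A l k * x k)   ∎

  -- Cauchy-Schwarz with some constant instead of the sharp one, which suffices for coercivity. The
  -- induction uses (u + s)² ≤ 2u² + 2s² to split off the first coordinate.
  ⟨⟩²-bounded : ∀ {m} (c : Vector Carrier m) →
                ∃ λ C → 0# ≤ C × (∀ x → ⟨ c , x ⟩ * ⟨ c , x ⟩ ≤ C * ∥ x ∥²)
  ⟨⟩²-bounded {zero}  c = 0# , ≤-refl , λ x → ≤-refl
  ⟨⟩²-bounded {suc m} c = (p + p) + (C + C) , 0≤2p+2C , bound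
    where
    p = c zero * c zero
    IH = ⟨⟩²-bounded (tail c)
    C = proj₁ IH
    0≤C = proj₁ (proj₂ IH)
    0≤2p+2C : 0# ≤ (p + p) + (C + C)
    0≤2p+2C = +-nonNegative (+-nonNegative (0≤x² _) (0≤x² _)) (+-nonNegative 0≤C 0≤C)
    bound : ∀ x → ⟨ c , x ⟩ * ⟨ c , x ⟩ ≤ ((p + p) + (C + C)) * ∥ x ∥²
    bound x = 0≤⇒≤
      (+-nonNegative (+-nonNegative (+-nonNegative s≤ s≤) (0≤x² (c zero * x zero - s)))
        (+-nonNegative (*-nonNegative (+-nonNegative (0≤x² _) (0≤x² _)) (0≤∥∥² (tail x)))
                       (*-nonNegative (+-nonNegative 0≤C 0≤C) (0≤x² (x zero)))))
      (solve 5 (λ c x s C n →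
        (c :* x :+ s) :* (c :* x :+ s) :+
          (((C :* n :- s :* s) :+ (C :* n :- s :* s)) :+ (c :* x :- s) :* (c :* x :- s) :+
           ((c :* c :+ c :* c) :* n :+ (C :+ C) :* (x :* x)))
        := ((c :* c :+ c :* c) :+ (C :+ C)) :* (x :* x :+ n))
        ≈-refl (c zero) (x zero) s C ∥ tail x ∥²)
      where
      s = ⟨ tail c , tail x ⟩
      s≤ : 0# ≤ C * ∥ tail x ∥² - s * s
      s≤ = ≤⇒0≤ (proj₂ (proj₂ IH) (tail x))

  -- Positive definiteness with one constant for all `x`. Uniformity is what lets a supremum be
  -- lowered in `max-eigenvector`; to get it from positivity at each nonzero vector would take
  -- compactness.
  Coercive : ∀ {m} → Matrix m → Set
  Coercive A = ∃ λ K → 0# ≤ K × (∀ x → 0# ≤ quadratic A x × ∥ x ∥² ≤ K * quadratic A x)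

  minor : ∀ {m} → Matrix (suc m) → Matrix m
  minor A k l = A (suc k) (suc l)

  -- Row and column are added because the form sees only their sum; for symmetric `A` this is twice
  -- the row.
  border : ∀ {m} → Matrix (suc m) → Vector Carrier m
  border A k = A zero (suc k) + A (suc k) zero

  quadratic-suc : ∀ {m} (A : Matrix (suc m)) x → quadratic A x ≈
    A zero zero * (x zero * x zero) + x zero * ⟨ border A , tail x ⟩ + quadratic (minor A) (tail x)
  quadratic-suc A x = begin-equality
    x₀ * (a * x₀ + r) + sum (λ k → x (suc k) * (A (suc k) zero * x₀ + (minor A ▹ tail x) k))
      ≈⟨ +-congˡ (≈-trans (sum-cong λ k → solve 4 (λ y b x q → y :* (b :* x :+ q) := x :* (b :* y) :+ y :* q)
           ≈-refl (x (suc k)) (A (suc k) zero) x₀ ((minor A ▹ tail x) k))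
         (≈-trans (∑-distrib-+ (λ k → x₀ * (A (suc k) zero * x (suc k))) (λ k → x (suc k) * (minor A ▹ tail x) k))
                  (+-congʳ (≈-sym (*-distribˡ-sum x₀ (λ k → A (suc k) zero * x (suc k))))))) ⟩
    x₀ * (a * x₀ + r) + (x₀ * c + q)
      ≈⟨ solve 5 (λ x a r c q → x :* (a :* x :+ r) :+ (x :* c :+ q) := a :* (x :* x) :+ x :* (r :+ c) :+ q)
           ≈-refl x₀ a r c q ⟩
    a * (x₀ * x₀) + x₀ * (r + c) + q
      ≈⟨ +-congʳ (+-congˡ (*-congˡ (≈-trans (sum-cong λ k → distribʳ (x (suc k)) _ _)
          (∑-distrib-+ (λ k → A zero (suc k) * x (suc k)) (λ k → A (suc k) zero * x (suc k)))))) ⟨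
    a * (x₀ * x₀) + x₀ * ⟨ border A , tail x ⟩ + q ∎
    where
    x₀ = x zero
    a = A zero zero
    r = ⟨ (λ k → A zero (suc k)) , tail x ⟩
    c = ⟨ (λ k → A (suc k) zero) , tail x ⟩
    q = quadratic (minor A) (tail x)

  module SchurComplement {m} (A : Matrix (suc m)) (0<a : 0# < A zero zero) where

    a = A zero zero

    a+a≉0 : ¬ (a + a ≈ 0#)
    a+a≉0 = >⇒≉ (<-≤-trans 0<a (0≤⇒≤ (proj₁ 0<a) ≈-refl))

    -- The shift of the first coordinate that completes the square. The divisor is `a + a` because
    -- `border` already contains both off-diagonal parts.
    γ : Vector Carrier m
    γ k = (a + a) ⁻¹ * border A k

    -- What is left of the form once the square is split off; for symmetric `A` it is the usual
    -- Schur complement of the corner entry.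
    complement : Matrix m
    complement k l = minor A k l - a * (γ k * γ l)

    ⟨border,x⟩ : ∀ x → ⟨ border A , x ⟩ ≈ (a + a) * ⟨ γ , x ⟩
    ⟨border,x⟩ x = ≈-sym (≈-trans (*-distribˡ-sum (a + a) (λ k → γ k * x k)) (sum-cong λ k → begin-equality
      (a + a) * ((a + a) ⁻¹ * border A k * x k)
        ≈⟨ solve 4 (λ u v b x → u :* (v :* b :* x)
            := (u :* v) :* (b :* x)) ≈-refl (a + a) ((a + a) ⁻¹) (border A k) (x k) ⟩
      ((a + a) * (a + a) ⁻¹) * (border A k * x k) ≈⟨ *-congʳ (⁻¹-inverseʳ a+a≉0) ⟩
      1# * (border A k * x k)                     ≈⟨ *-identityˡ _ ⟩
      border A k * x k ∎))

    quadratic-complement : ∀ x →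
      quadratic complement x ≈ quadratic (minor A) x - a * (⟨ γ , x ⟩ * ⟨ γ , x ⟩)
    quadratic-complement x = begin-equality
      ⟨ x , complement ▹ x ⟩
        ≈⟨ ⟨⟩-cong (λ k → ≈-refl) row ⟩
      ⟨ x , (λ k → 1# * (minor A ▹ x) k + - (a * g) * γ k) ⟩
        ≈⟨ ⟨⟩-linearʳ x 1# (minor A ▹ x) (- (a * g)) γ ⟩
      1# * quadratic (minor A) x + - (a * g) * ⟨ x , γ ⟩
        ≈⟨ +-cong (*-identityˡ _) (*-congˡ (⟨⟩-comm x γ)) ⟩
      quadratic (minor A) x + - (a * g) * g
        ≈⟨ +-congˡ (solve 2 (λ a g → :- (a :* g) :* g := :- (a :* (g :* g))) ≈-refl a g) ⟩
      quadratic (minor A) x - a * (g * g) ∎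
      where
      g = ⟨ γ , x ⟩
      row : ∀ k → (complement ▹ x) k ≈ 1# * (minor A ▹ x) k + - (a * g) * γ k
      row k = begin-equality
        (sum λ l → (minor A k l - a * (γ k * γ l)) * x l)
          ≈⟨ sum-cong (λ l → ≈-trans (solve 5 (λ b a c d x → (b :- a :* (c :* d)) :* x
              := b :* x :+ (:- (a :* c)) :* (d :* x))
               ≈-refl (minor A k l) a (γ k) (γ l) (x l)) (+-congʳ (≈-sym (*-identityˡ _)))) ⟩
        (sum λ l → 1# * (minor A k l * x l) + - (a * γ k) * (γ l * x l))
          ≈⟨ sum-linear 1# (λ l → minor A k l * x l) (- (a * γ k)) (λ l → γ l * x l) ⟩
        1# * (minor A ▹ x) k + - (a * γ k) * g
          ≈⟨ +-congˡ (solve 3 (λ a c g → (:- (a :* c)) :* g := :- (a :* g) :* c) ≈-refl a (γ k) g) ⟩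
        1# * (minor A ▹ x) k + - (a * g) * γ k ∎

    complete-square : ∀ x → quadratic A x ≈
      a * ((x zero + ⟨ γ , tail x ⟩) * (x zero + ⟨ γ , tail x ⟩)) + quadratic complement (tail x)
    complete-square x = begin-equality
      quadratic A x
        ≈⟨ quadratic-suc A x ⟩
      a * (x₀ * x₀) + x₀ * ⟨ border A , tail x ⟩ + q
        ≈⟨ +-congʳ (+-congˡ (*-congˡ (⟨border,x⟩ (tail x)))) ⟩
      a * (x₀ * x₀) + x₀ * ((a + a) * g) + q
        ≈⟨ solve 4 (λ a x g q → a :* (x :* x) :+ x :* ((a :+ a) :* g) :+ q
            := a :* ((x :+ g) :* (x :+ g)) :+ (q :- a :* (g :* g)))
             ≈-refl a x₀ g q ⟩
      a * ((x₀ + g) * (x₀ + g)) + (q - a * (g * g))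
        ≈⟨ +-congˡ (quadratic-complement (tail x)) ⟨
      a * ((x₀ + g) * (x₀ + g)) + quadratic complement (tail x) ∎
      where
      x₀ = x zero
      g = ⟨ γ , tail x ⟩
      q = quadratic (minor A) (tail x)

    -- This first coordinate makes the completed square vanish. A vector on which the complement is
    -- nonpositive therefore lifts to one for `A`, and the extra coordinate can only enlarge its
    -- norm.
    quadratic-extend : ∀ x → quadratic A (- ⟨ γ , x ⟩ ∷ x) ≈ quadratic complement x
    quadratic-extend x = begin-equality
      quadratic A (- g ∷ x)
        ≈⟨ complete-square (- g ∷ x) ⟩
      a * ((- g + g) * (- g + g)) + quadratic complement x
        ≈⟨ solve 3 (λ a g q → a :* ((:- g :+ g) :* (:- g :+ g)) :+ q := q) ≈-refl a g (quadratic complement x) ⟩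
      quadratic complement x ∎
      where g = ⟨ γ , x ⟩

    -- With g = ⟨γ, tail x⟩, x₀² ≤ 2(x₀ + g)² + 2g² and g² ≤ C n, where n is the squared norm of the
    -- tail. Hence ∥x∥² ≤ 2(x₀ + g)² + (1 + 2C) n; the first term is 2 `a ⁻¹` times the split-off
    -- square, and n is at most `K` times the complement.
    coercive-extend : Coercive complement → Coercive A
    coercive-extend (K , 0≤K , bound) = a ⁻¹ + a ⁻¹ + D * K , 0≤L , λ x →
      ≤-trans (+-nonNegative (*-nonNegative (proj₁ 0<a) (0≤x² _)) (proj₁ (bound (tail x))))
              (≤-reflexive (≈-sym (complete-square x))) ,
      norm-bound x
      where
      C = proj₁ (⟨⟩²-bounded γ)
      D = 1# + (C + C)
      0≤C = proj₁ (proj₂ (⟨⟩²-bounded γ))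
      0≤D : 0# ≤ D
      0≤D = +-nonNegative 0≤1 (+-nonNegative 0≤C 0≤C)
      0≤a⁻¹ = 0≤⁻¹ 0<a
      0≤L : 0# ≤ a ⁻¹ + a ⁻¹ + D * K
      0≤L = +-nonNegative (+-nonNegative 0≤a⁻¹ 0≤a⁻¹) (*-nonNegative 0≤D 0≤K)
      norm-bound : ∀ x → ∥ x ∥² ≤ (a ⁻¹ + a ⁻¹ + D * K) * quadratic A x
      norm-bound x = begin
        x₀ * x₀ + n
          ≤⟨ 0≤⇒≤ (+-nonNegative (+-nonNegative c c) (0≤x² (x₀ + (g + g))))
               (solve 4 (λ x g C n → x :* x :+ n :+ ((C :* n :- g :* g) :+ (C :* n :- g :* g) :+ (x :+ (g :+ g)) :* (x :+ (g :+ g)))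
                 := ((x :+ g) :* (x :+ g) :+ (x :+ g) :* (x :+ g)) :+ (n :+ (C :+ C) :* n)) ≈-refl x₀ g C n) ⟩
        (u + u) + (n + (C + C) * n)
          ≈⟨ +-cong (≈-sym (≈-trans (distribʳ (a * u) (a ⁻¹) (a ⁻¹)) (+-cong (cancel u) (cancel u))))
                    (≈-trans (+-congʳ (≈-sym (*-identityˡ n))) (≈-sym (distribʳ n _ _))) ⟩
        (a ⁻¹ + a ⁻¹) * (a * u) + D * n
          ≤⟨ +-mono-≤ ≤-refl (*-monoˡ-≤ 0≤D (proj₂ (bound (tail x)))) ⟩
        (a ⁻¹ + a ⁻¹) * (a * u) + D * (K * s)
          ≤⟨ 0≤⇒≤ (+-nonNegative (*-nonNegative (+-nonNegative 0≤a⁻¹ 0≤a⁻¹) 0≤s)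
                                 (*-nonNegative (*-nonNegative 0≤D 0≤K) (*-nonNegative (proj₁ 0<a) (0≤x² _))))
               (solve 5 (λ b v s D K → b :* v :+ D :* (K :* s) :+ (b :* s :+ (D :* K) :* v)
                   := (b :+ D :* K) :* (v :+ s))
                 ≈-refl (a ⁻¹ + a ⁻¹) (a * u) s D K) ⟩
        (a ⁻¹ + a ⁻¹ + D * K) * (a * u + s)
          ≈⟨ *-congˡ (complete-square x) ⟨
        (a ⁻¹ + a ⁻¹ + D * K) * quadratic A x ∎
        where
        x₀ = x zero
        n = ∥ tail x ∥²
        g = ⟨ γ , tail x ⟩
        u = (x₀ + g) * (x₀ + g)
        s = quadratic complement (tail x)
        0≤s = proj₁ (bound (tail x))
        c : 0# ≤ C * n - g * g
        c = ≤⇒0≤ (proj₂ (proj₂ (⟨⟩²-bounded γ)) (tail x))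
        cancel : ∀ v → a ⁻¹ * (a * v) ≈ v
        cancel v = ≈-trans (≈-sym (*-assoc _ _ _)) (≈-trans (*-congʳ (⁻¹-inverseˡ (>⇒≉ 0<a))) (*-identityˡ v))

  coercive? : ∀ {m} (A : Matrix m) →
              (∃ λ x → 0# < ∥ x ∥² × quadratic A x ≤ 0#) ⊎ Coercive A
  coercive? {zero}  A = inj₂ (0# , ≤-refl , λ x → ≤-refl , ≤-reflexive (≈-sym (zeroˡ 0#)))
  coercive? {suc m} A with A zero zero ≤? 0#
  ... | yes a≤0 = inj₁ (e₀ ,
      <-≤-trans 0<1 (≤-reflexive ∥e₀∥²≈1) ,
      ≤-trans (≤-reflexive q≈a) a≤0)
    where
    e₀ : Vector Carrier (suc m)
    e₀ = 1# ∷ λ _ → 0#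
    ∥e₀∥²≈1 : 1# ≈ ∥ e₀ ∥²
    ∥e₀∥²≈1 = ≈-sym (≈-trans (+-cong (*-identityˡ 1#) (sum-zero {m} λ k → zeroˡ 0#)) (+-identityʳ 1#))
    q≈a : quadratic A e₀ ≈ A zero zero
    q≈a = ≈-trans (quadratic-suc A e₀) (≈-trans
      (+-cong (+-cong (≈-trans (*-congˡ (*-identityˡ 1#)) (*-identityʳ _))
                      (≈-trans (*-identityˡ _) (sum-zero λ k → zeroʳ (border A k))))
              (sum-zero λ k → zeroˡ ((minor A ▹ λ _ → 0#) k)))
      (≈-trans (+-identityʳ _) (+-identityʳ _)))
  ... | no a≰0 with coercive? (SchurComplement.complement A (≰⇒> a≰0))
  ...   | inj₂ coercive = inj₂ (SchurComplement.coercive-extend A (≰⇒> a≰0) coercive)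
  ...   | inj₁ (x , 0<∥x∥² , q≤0) = inj₁ (- ⟨ γ , x ⟩ ∷ x ,
      <-≤-trans 0<∥x∥² (0≤⇒≤ (0≤x² (- ⟨ γ , x ⟩)) (+-comm _ _)) ,
      ≤-trans (≤-reflexive (quadratic-extend x)) q≤0)
    where open SchurComplement A (≰⇒> a≰0)

  -- Moving from `x` against z = `B ▹ x` changes the form by -2∥z∥² to first order, which would make
  -- it negative unless z = 0. The step length p / (1 + q), with p = ∥z∥² and q the form at z, keeps
  -- the second-order term smaller; the denominator is cleared by scaling `x` with 1 + q.
  semidefinite-kernel : ∀ {m} {B : Matrix m} → (∀ k l → B k l ≈ B l k) → (∀ x → 0# ≤ quadratic B x) →
                        ∀ {x} → quadratic B x ≤ 0# → ∀ k → (B ▹ x) k ≈ 0#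
  semidefinite-kernel {B = B} B-sym 0≤B {x} Bx≤0 = ∥∥²≤0⇒≈0 p≤0
    where
    z = B ▹ x
    p = ∥ z ∥²
    q = quadratic B z
    0≤q = 0≤B z
    expand : ∀ a b → quadratic B (λ k → a * x k + b * z k) ≈
             a * a * quadratic B x + (a * b + a * b) * p + b * b * q
    expand a b = begin-equality
      quadratic B (λ k → a * x k + b * z k)
        ≈⟨ ⟨⟩-cong (λ k → ≈-refl) (▹-linear B a x b z) ⟩
      ⟨ (λ k → a * x k + b * z k) , (λ k → a * z k + b * (B ▹ z) k) ⟩
        ≈⟨ ⟨⟩-linearʳ _ a z b (B ▹ z) ⟩
      a * ⟨ (λ k → a * x k + b * z k) , z ⟩ + b * ⟨ (λ k → a * x k + b * z k) , B ▹ z ⟩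
        ≈⟨ +-cong (*-congˡ (⟨⟩-linearˡ a x b z z)) (*-congˡ (⟨⟩-linearˡ a x b z (B ▹ z))) ⟩
      a * (a * quadratic B x + b * p) + b * (a * ⟨ x , B ▹ z ⟩ + b * q)
        ≈⟨ +-congˡ (*-congˡ (+-congʳ (*-congˡ (▹-comm B-sym x z)))) ⟩
      a * (a * quadratic B x + b * p) + b * (a * p + b * q)
        ≈⟨ solve 5 (λ a b r p q → a :* (a :* r :+ b :* p) :+ b :* (a :* p :+ b :* q)
             := a :* a :* r :+ (a :* b :+ a :* b) :* p :+ b :* b :* q) ≈-refl a b (quadratic B x) p q ⟩
      a * a * quadratic B x + (a * b + a * b) * p + b * b * q ∎
    a = 1# + q
    -- The value of the form at a x − p z is at most −(2 + q) p².
    2p²≤0 : p * p + p * p ≤ 0#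
    2p²≤0 = 0≤⇒≤
      (+-nonNegative (0≤B (λ k → a * x k + (- p) * z k))
        (+-nonNegative (*-nonNegative (0≤x² a) (≤0⇒0≤- Bx≤0)) (*-nonNegative 0≤q (0≤x² p))))
      (begin-equality
        p * p + p * p + (quadratic B (λ k → a * x k + (- p) * z k) + (a * a * - quadratic B x + q * (p * p)))
          ≈⟨ +-congˡ (+-congʳ (expand a (- p))) ⟩
        p * p + p * p + (a * a * quadratic B x + (a * - p + a * - p) * p + - p * - p * q + (a * a * - quadratic B x + q * (p * p)))
          ≈⟨ solve 3 (λ p q r → let a = con (+ 1) :+ q in
               p :* p :+ p :* p :+ (a :* a :* r :+ (a :* (:- p) :+ a :* (:- p)) :* p :+ (:- p) :* (:- p) :* q :+ (a :* a :* (:- r) :+ q :* (p :* p)))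
               := con (+ 0)) ≈-refl p q (quadratic B x) ⟩
        0# ∎)
    p≤0 : p ≤ 0#
    p≤0 = ≤-reflexive (x²≤0⇒x≈0 (≤-trans (0≤⇒≤ (0≤x² p) ≈-refl) 2p²≤0))

  max-eigenvector : ∀ {m} (A : Matrix m) → (∀ k l → A k l ≈ A l k) →
    ∀ {M} → (∀ x → quadratic A x ≤ M * ∥ x ∥²) → ∀ {y} → 0# < ∥ y ∥² →
    ∃₂ λ μ x → 0# < ∥ x ∥² × (∀ k → (A ▹ x) k ≈ μ * x k) × (∀ z → quadratic A z ≤ μ * ∥ z ∥²)
  max-eigenvector {m} A A-sym {M} A≤M {y} 0<∥y∥² =
    μ , x , proj₁ (proj₂ kernel) , eigen , rayleigh≤μ
    where
    -- All lower bounds of single Rayleigh quotients, with the division multiplied out; the supremum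
    -- is that of the quotients themselves. The vector `y` makes the set inhabited.
    S : Carrier → Set
    S c = ∃ λ x → 0# < ∥ x ∥² × c * ∥ x ∥² ≤ quadratic A x
    quotient : ∀ x → 0# < ∥ x ∥² → quadratic A x * ∥ x ∥² ⁻¹ * ∥ x ∥² ≈ quadratic A x
    quotient x 0<n = ≈-trans (*-assoc _ _ _) (≈-trans (*-congˡ (⁻¹-inverseˡ (>⇒≉ 0<n))) (*-identityʳ _))
    quotient∈S : ∀ x → 0# < ∥ x ∥² → S (quadratic A x * ∥ x ∥² ⁻¹)
    quotient∈S x 0<n = x , 0<n , ≤-reflexive (quotient x 0<n)
    S-bounded : ∀ {c} → S c → c ≤ M
    S-bounded {c} (x , 0<n , cn≤) = *-cancelˡ-≤ 0<n
      (≤-trans (≤-reflexive (*-comm _ c)) (≤-trans cn≤ (≤-trans (A≤M x) (≤-reflexive (*-comm M _)))))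
    sup = supremum S (_ , quotient∈S y 0<∥y∥²) (M , S-bounded)
    μ = proj₁ sup
    S≤μ : ∀ {c} → S c → c ≤ μ
    S≤μ = proj₁ (proj₂ sup)
    rayleigh≤μ : ∀ z → quadratic A z ≤ μ * ∥ z ∥²
    rayleigh≤μ z with ∥∥²≈0⊎0<∥∥² z
    ... | inj₁ n≈0 = begin
      quadratic A z ≤⟨ A≤M z ⟩
      M * ∥ z ∥²    ≈⟨ *-congˡ n≈0 ⟩
      M * 0#        ≈⟨ zeroʳ M ⟩
      0#            ≈⟨ zeroʳ μ ⟨
      μ * 0#        ≈⟨ *-congˡ n≈0 ⟨
      μ * ∥ z ∥²    ∎
    ... | inj₂ 0<n = begin
      quadratic A z                          ≈⟨ quotient z 0<n ⟨
      quadratic A z * ∥ z ∥² ⁻¹ * ∥ z ∥²     ≈⟨ *-comm _ _ ⟩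
      ∥ z ∥² * (quadratic A z * ∥ z ∥² ⁻¹)   ≤⟨ *-monoˡ-≤ (proj₁ 0<n) (S≤μ (quotient∈S z 0<n)) ⟩
      ∥ z ∥² * μ                             ≈⟨ *-comm _ _ ⟩
      μ * ∥ z ∥²                             ∎
    B : Matrix m
    B k l = μ * δ k l - A k l
    B▹ : ∀ x k → (B ▹ x) k ≈ μ * x k + - 1# * (A ▹ x) k
    B▹ x k = begin-equality
      (sum λ l → (μ * δ k l - A k l) * x l)
        ≈⟨ sum-cong (λ l → solve 4 (λ μ d a x → (μ :* d :- a) :* x
            := μ :* (d :* x) :+ (:- con (+ 1)) :* (a :* x))
             ≈-refl μ (δ k l) (A k l) (x l)) ⟩
      (sum λ l → μ * (δ k l * x l) + - 1# * (A k l * x l))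
        ≈⟨ sum-linear μ (λ l → δ k l * x l) (- 1#) (λ l → A k l * x l) ⟩
      μ * sum (λ l → δ k l * x l) + - 1# * (A ▹ x) k
        ≈⟨ +-congʳ (*-congˡ (sum-δ k x)) ⟩
      μ * x k + - 1# * (A ▹ x) k ∎
    B-quadratic : ∀ x → quadratic B x ≈ μ * ∥ x ∥² - quadratic A x
    B-quadratic x = ≈-trans (⟨⟩-cong (λ k → ≈-refl) (B▹ x)) (≈-trans (⟨⟩-linearʳ x μ x (- 1#) (A ▹ x))
      (+-congˡ (solve 1 (λ q → (:- con (+ 1)) :* q := :- q) ≈-refl (quadratic A x))))
    -- Coercivity would give 1 ≤ K(μ - c) for every c in `S`, so μ - 1/(1 + K) would be a smaller
    -- upper bound. The 1 is added because `K` is only known to be nonnegative.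
    not-coercive : ¬ Coercive B
    not-coercive (K , 0≤K , bound) = proj₂ 0<1 (≤-antisym 0≤1 1≤0)
      where
      ε = (1# + K) ⁻¹
      0<1+K : 0# < 1# + K
      0<1+K = <-≤-trans 0<1 (0≤⇒≤ 0≤K ≈-refl)
      S≤μ-ε : ∀ {c} → S c → c ≤ μ - ε
      S≤μ-ε {c} (x , 0<n , cn≤) = 0≤⇒≤ (≤⇒0≤ ε≤μ-c)
        (solve 3 (λ c μ ε → c :+ (μ :- c :- ε) := μ :- ε) ≈-refl c μ ε)
        where
        1≤K[μ-c] : 1# ≤ K * (μ - c)
        1≤K[μ-c] = *-cancelˡ-≤ 0<n (begin
          ∥ x ∥² * 1#                        ≈⟨ *-identityʳ _ ⟩
          ∥ x ∥²                             ≤⟨ proj₂ (bound x) ⟩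
          K * quadratic B x                  ≈⟨ *-congˡ (B-quadratic x) ⟩
          K * (μ * ∥ x ∥² - quadratic A x)   ≤⟨ *-monoˡ-≤ 0≤K (0≤⇒≤ (≤⇒0≤ cn≤)
            (solve 3 (λ u q v → u :- q :+ (q :- v)
                := u :- v) ≈-refl (μ * ∥ x ∥²) (quadratic A x) (c * ∥ x ∥²))) ⟩
          K * (μ * ∥ x ∥² - c * ∥ x ∥²)      ≈⟨ solve 4 (λ K μ c n → K :* (μ :* n :- c :* n)
              := n :* (K :* (μ :- c)))
            ≈-refl K μ c ∥ x ∥² ⟩
          ∥ x ∥² * (K * (μ - c))             ∎)
        ε≤μ-c : ε ≤ μ - c
        ε≤μ-c = *-cancelˡ-≤ 0<1+K (begin
          (1# + K) * ε          ≈⟨ ⁻¹-inverseʳ (>⇒≉ 0<1+K) ⟩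
          1#                    ≤⟨ 1≤K[μ-c] ⟩
          K * (μ - c)           ≤⟨ 0≤⇒≤ (≤⇒0≤ (S≤μ (x , 0<n , cn≤)))
            (solve 2 (λ K d → K :* d :+ d := (con (+ 1) :+ K) :* d) ≈-refl K (μ - c)) ⟩
          (1# + K) * (μ - c)    ∎)
      ε≤0 : ε ≤ 0#
      ε≤0 = 0≤⇒≤ (≤⇒0≤ (proj₂ (proj₂ sup) S≤μ-ε)) (solve 2 (λ ε μ → ε :+ (μ :- ε :- μ) := con (+ 0)) ≈-refl ε μ)
      1≤0 : 1# ≤ 0#
      1≤0 = begin
        1#            ≈⟨ ⁻¹-inverseʳ (>⇒≉ 0<1+K) ⟨
        (1# + K) * ε  ≤⟨ *-monoˡ-≤ (proj₁ 0<1+K) ε≤0 ⟩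
        (1# + K) * 0# ≈⟨ zeroʳ _ ⟩
        0#            ∎
    kernel : ∃ λ x → 0# < ∥ x ∥² × quadratic B x ≤ 0#
    kernel with coercive? B
    ... | inj₁ x        = x
    ... | inj₂ coercive = contradiction coercive not-coercive
    x = proj₁ kernel
    B-sym : ∀ k l → B k l ≈ B l k
    B-sym k l = +-cong (*-congˡ (δ-sym k l)) (-‿cong (A-sym k l))
    0≤B : ∀ z → 0# ≤ quadratic B z
    0≤B z = ≤-trans (≤⇒0≤ (rayleigh≤μ z)) (≤-reflexive (≈-sym (B-quadratic z)))
    eigen : ∀ k → (A ▹ x) k ≈ μ * x k
    eigen k = begin-equality
      (A ▹ x) k                                    ≈⟨ solve 2 (λ a b → a
          := b :- (b :+ (:- con (+ 1)) :* a)) ≈-refl _ _ ⟩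
      μ * x k - (μ * x k + - 1# * (A ▹ x) k)       ≈⟨ +-congˡ (-‿cong (≈-trans (≈-sym (B▹ x k))
        (semidefinite-kernel B-sym 0≤B (proj₂ (proj₂ kernel)) k))) ⟩
      μ * x k - 0#                                 ≈⟨ solve 1 (λ a → a :- con (+ 0) := a) ≈-refl _ ⟩
      μ * x k                                      ∎

  0<∥∥²⇒≉0 : ∀ {m} {x : Vector Carrier m} → 0# < ∥ x ∥² → ∃ λ k → ¬ (x k ≈ 0#)
  0<∥∥²⇒≉0 {m} {x} 0<n with Fin.any? (λ k → ¬? (x k ≟ 0#))
  ... | yes ∃k = ∃k
  ... | no ∄k  = contradiction (≈-sym n≈0) (proj₂ 0<n)
    where
    n≈0 : ∥ x ∥² ≈ 0#
    n≈0 = sum-zero λ k → ≈-trans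
      (*-congˡ (decidable-stable (x k ≟ 0#) λ xₖ≉0 → ∄k (k , xₖ≉0))) (zeroʳ (x k))

  ≉0⇒0<∥∥² : ∀ {m} {x : Vector Carrier m} → (∃ λ k → ¬ (x k ≈ 0#)) → 0# < ∥ x ∥²
  ≉0⇒0<∥∥² {x = x} (k , xₖ≉0) = <-≤-trans (0<x² xₖ≉0) (term≤sum (λ l → 0≤x² (x l)) k)

-- The effect of one gossip step.

module GossipStep (ℝ : CompleteOrderedField) where

  open OrderedField ℝ
  open QuadraticForms ℝ
  open ≤-Reasoning

  δ-refl : ∀ {n} (i : Fin n) → δ i i ≈ 1#
  δ-refl zero    = ≈-refl
  δ-refl (suc i) = δ-refl i

  δ-≢ : ∀ {n} {i k : Fin n} → i ≢ k → δ i k ≈ 0#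
  δ-≢ {i = i} {k} i≢k with i Fin.≟ k
  ... | yes i≡k = contradiction i≡k i≢k
  ... | no  _   = ≈-refl

  module _ {m n} {i i′ : Fin m} (i≢i′ : i ≢ i′) (b : Scores m n) (j : Fin n) (φ : Carrier → Carrier) where

    new = φ (half * (b i j + b i′ j))

    -- The δ terms exchange the two old values for the new ones, placed so that nothing is
    -- subtracted. A general `φ` serves both the sum of deviations and the energy.
    φ-step : ∀ l → φ (step (i , i′) b l j) + (δ i l * φ (b i j) + δ i′ l * φ (b i′ j)) ≈
                   φ (b l j) + (δ i l * new + δ i′ l * new)
    φ-step l with l Fin.≟ i | l Fin.≟ i′
    ... | yes ≡.refl | yes ≡.refl = contradiction ≡.refl i≢i′
    ... | yes ≡.refl | no  _ = begin-equality
      new + (δ i i * φ (b i j) + δ i′ i * φ (b i′ j))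
        ≈⟨ +-congˡ (+-cong (*-congʳ (δ-refl i)) (*-congʳ (δ-≢ λ i′≡i → i≢i′ (≡.sym i′≡i)))) ⟩
      new + (1# * φ (b i j) + 0# * φ (b i′ j))
        ≈⟨ solve 3 (λ x y z → x :+ (con (+ 1) :* y :+ con (+ 0) :* z)
            := y :+ (con (+ 1) :* x :+ con (+ 0) :* x))
             ≈-refl new (φ (b i j)) (φ (b i′ j)) ⟩
      φ (b i j) + (1# * new + 0# * new)
        ≈⟨ +-congˡ (+-cong (*-congʳ (δ-refl i)) (*-congʳ (δ-≢ λ i′≡i → i≢i′ (≡.sym i′≡i)))) ⟨
      φ (b i j) + (δ i i * new + δ i′ i * new) ∎
    ... | no  _ | yes ≡.refl = begin-equality
      new + (δ i i′ * φ (b i j) + δ i′ i′ * φ (b i′ j))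
        ≈⟨ +-congˡ (+-cong (*-congʳ (δ-≢ i≢i′)) (*-congʳ (δ-refl i′))) ⟩
      new + (0# * φ (b i j) + 1# * φ (b i′ j))
        ≈⟨ solve 3 (λ x y z → x :+ (con (+ 0) :* y :+ con (+ 1) :* z)
            := z :+ (con (+ 0) :* x :+ con (+ 1) :* x))
             ≈-refl new (φ (b i j)) (φ (b i′ j)) ⟩
      φ (b i′ j) + (0# * new + 1# * new)
        ≈⟨ +-congˡ (+-cong (*-congʳ (δ-≢ i≢i′)) (*-congʳ (δ-refl i′))) ⟨
      φ (b i′ j) + (δ i i′ * new + δ i′ i′ * new) ∎
    ... | no l≢i | no l≢i′ = +-congˡ (≈-trans (+-cong (vanish l≢i) (vanish l≢i′)) (≈-sym (+-cong (vanish l≢i) (vanish l≢i′))))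
      where
      vanish : ∀ {k x} → l ≢ k → δ k l * x ≈ 0#
      vanish l≢k = ≈-trans (*-congʳ (δ-≢ λ k≡l → l≢k (≡.sym k≡l))) (zeroˡ _)

    sum-step : sum (λ l → φ (step (i , i′) b l j)) + (φ (b i j) + φ (b i′ j)) ≈
               sum (λ l → φ (b l j)) + (new + new)
    sum-step = begin-equality
      sum (λ l → φ (step (i , i′) b l j)) + (φ (b i j) + φ (b i′ j))
        ≈⟨ +-congˡ (two-terms (φ (b i j)) (φ (b i′ j))) ⟨
      sum (λ l → φ (step (i , i′) b l j)) + sum (λ l → δ i l * φ (b i j) + δ i′ l * φ (b i′ j))
        ≈⟨ ∑-distrib-+ (λ l → φ (step (i , i′) b l j)) (λ l → δ i l * φ (b i j) + δ i′ l * φ (b i′ j)) ⟨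
      sum (λ l → φ (step (i , i′) b l j) + (δ i l * φ (b i j) + δ i′ l * φ (b i′ j)))
        ≈⟨ sum-cong φ-step ⟩
      sum (λ l → φ (b l j) + (δ i l * new + δ i′ l * new))
        ≈⟨ ∑-distrib-+ (λ l → φ (b l j)) (λ l → δ i l * new + δ i′ l * new) ⟩
      sum (λ l → φ (b l j)) + sum (λ l → δ i l * new + δ i′ l * new)
        ≈⟨ +-congˡ (two-terms new new) ⟩
      sum (λ l → φ (b l j)) + (new + new) ∎
      where
      two-terms : ∀ x y → sum (λ l → δ i l * x + δ i′ l * y) ≈ x + y
      two-terms x y = ≈-trans (∑-distrib-+ (λ l → δ i l * x) (λ l → δ i′ l * y))
                              (+-cong (sum-δ i (λ _ → x)) (sum-δ i′ (λ _ → y)))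

  deviation : ∀ {m n} → Carrier → Scores m n → Fin n → Vector Carrier m
  deviation c b j l = b l j - c

  energy : ∀ {m n} → Carrier → Scores m n → Fin n → Carrier
  energy c b j = ∥ deviation c b j ∥²

  module _ {m n} {i i′ : Fin m} (i≢i′ : i ≢ i′) (c : Carrier) (b : Scores m n) (j : Fin n) where

    -- Keeps the deviations from a fixed centre in the space of sum 0, where the contraction by `λ₂`
    -- applies, throughout the induction on time.
    sum-deviation-step : sum (deviation c (step (i , i′) b) j) ≈ sum (deviation c b j)
    sum-deviation-step = begin-equality
      s′                   ≈⟨ solve 2 (λ s u → s := s :+ u :- u) ≈-refl s′ (x - c + (y - c)) ⟩
      s′ + (x - c + (y - c)) - (x - c + (y - c))
        ≈⟨ +-congʳ (sum-step i≢i′ b j (_- c)) ⟩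
      s + (half * (x + y) - c + (half * (x + y) - c)) - (x - c + (y - c))
        ≈⟨ solve 5 (λ s h x y c → s :+ (h :* (x :+ y) :- c :+ (h :* (x :+ y) :- c)) :- (x :- c :+ (y :- c))
             := s :+ (h :+ h :- con (+ 1)) :* (x :+ y)) ≈-refl s half x y c ⟩
      s + (half + half - 1#) * (x + y)
        ≈⟨ +-congˡ (*-congʳ half+half-1≈0) ⟩
      s + 0# * (x + y)     ≈⟨ solve 2 (λ s u → s :+ con (+ 0) :* u := s) ≈-refl s (x + y) ⟩
      s ∎
      where
      s = sum (deviation c b j)
      s′ = sum (deviation c (step (i , i′) b) j)
      x = b i j
      y = b i′ j

    -- The parallelogram law. The right-hand side is the form of `projection i i′` at the
    -- deviations, which is how the matrix W enters.
    energy-step : let y = deviation c b j in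
      energy c (step (i , i′) b) j ≈ energy c b j - half * ((y i - y i′) * (y i - y i′))
    energy-step = begin-equality
      e′                   ≈⟨ solve 2 (λ s u → s := s :+ u :- u) ≈-refl e′ w ⟩
      e′ + w - w           ≈⟨ +-congʳ (sum-step i≢i′ b j (λ z → (z - c) * (z - c))) ⟩
      e + (z * z + z * z) - w
        -- (h + h) - 1 divides 2 (h (x + y) - c)² + h (x - y)² - (x - c)² - (y - c)².
        ≈⟨ solve 5 (λ e h x y c →
             e :+ ((h :* (x :+ y) :- c) :* (h :* (x :+ y) :- c) :+ (h :* (x :+ y) :- c) :* (h :* (x :+ y) :- c))
               :- ((x :- c) :* (x :- c) :+ (y :- c) :* (y :- c))
             := e :- h :* ((x :- c :- (y :- c)) :* (x :- c :- (y :- c)))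
               :+ (h :+ h :- con (+ 1)) :* (h :* ((x :+ y) :* (x :+ y)) :+ (x :* x :+ y :* y) :- (c :+ c) :* (x :+ y)))
             ≈-refl e half x y c ⟩
      e - half * (d * d) + (half + half - 1#) * (half * ((x + y) * (x + y)) + (x * x + y * y) - (c + c) * (x + y))
        ≈⟨ +-congˡ (≈-trans (*-congʳ half+half-1≈0) (zeroˡ _)) ⟩
      e - half * (d * d) + 0#
        ≈⟨ +-identityʳ _ ⟩
      e - half * (d * d) ∎
      where
      e = energy c b j
      e′ = energy c (step (i , i′) b) j
      x = b i j
      y = b i′ j
      d = (x - c) - (y - c)
      w = (x - c) * (x - c) + (y - c) * (y - c)
      z = half * (x + y) - c

  -- Expectation over one random edge, and the gossip matrix.

  module EdgeDistribution {m} (G : Graph m) (P : Fin m → Fin m → Carrier) (isDist : IsEdgeDistribution G P) where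

    open Graph G
    open IsEdgeDistribution isDist

    edge? : ∀ i i′ → Dec (i Fin.< i′ × i ~ i′)
    edge? i i′ = (i Fin.<? i′) ×-dec ~-dec i i′

    E : (Fin m → Fin m → Carrier) → Carrier
    E f = sumEdges G λ i i′ → P i i′ * f i i′

    if-cong : ∀ {A : Set} (a? : Dec A) {x y} → (A → x ≈ y) →
              (if does a? then x else 0#) ≈ (if does a? then y else 0#)
    if-cong (yes a) x≈y = x≈y a
    if-cong (no _)  x≈y = ≈-refl

    if-mono : ∀ {A : Set} (a? : Dec A) {x y} → (A → x ≤ y) →
              (if does a? then x else 0#) ≤ (if does a? then y else 0#)
    if-mono (yes a) x≤y = x≤y a
    if-mono (no _)  x≤y = ≤-refl

    if-linear : ∀ {A : Set} (a? : Dec A) a x b y → (if does a? then a * x + b * y else 0#) ≈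
                a * (if does a? then x else 0#) + b * (if does a? then y else 0#)
    if-linear (yes _) a x b y = ≈-refl
    if-linear (no _)  a x b y = solve 2 (λ a b → con (+ 0) := a :* con (+ 0) :+ b :* con (+ 0)) ≈-refl a b

    sumEdges-cong : ∀ {f g} → (∀ {i i′} → i Fin.< i′ → i ~ i′ → f i i′ ≈ g i i′) → sumEdges G f ≈ sumEdges G g
    sumEdges-cong f≈g = sum-cong λ i → sum-cong λ i′ → if-cong (edge? i i′) λ (i<i′ , i~i′) → f≈g i<i′ i~i′

    sumEdges-mono : ∀ {f g} → (∀ {i i′} → i Fin.< i′ → i ~ i′ → f i i′ ≤ g i i′) → sumEdges G f ≤ sumEdges G g
    sumEdges-mono f≤g = sum-mono-≤ λ i → sum-mono-≤ λ i′ → if-mono (edge? i i′) λ (i<i′ , i~i′) → f≤g i<i′ i~i′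

    sumEdges-linear : ∀ a f b g → sumEdges G (λ i i′ → a * f i i′ + b * g i i′) ≈ a * sumEdges G f + b * sumEdges G g
    sumEdges-linear a f b g = ≈-trans
      (sum-cong λ i → ≈-trans (sum-cong λ i′ → if-linear (edge? i i′) a (f i i′) b (g i i′))
                              (sum-linear a (λ i′ → on-edge f i i′) b (λ i′ → on-edge g i i′)))
      (sum-linear a (λ i → sum (on-edge f i)) b (λ i → sum (on-edge g i)))
      where
      on-edge : (Fin m → Fin m → Carrier) → Fin m → Fin m → Carrier
      on-edge h i i′ = if does (edge? i i′) then h i i′ else 0#

    edge≤sumEdges : ∀ {f} → (∀ {i i′} → i Fin.< i′ → i ~ i′ → 0# ≤ f i i′) →
                    ∀ {i i′} → i Fin.< i′ → i ~ i′ → f i i′ ≤ sumEdges G f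
    edge≤sumEdges {f} 0≤f {i} {i′} i<i′ i~i′ = begin
      f i i′               ≈⟨ selected (edge? i i′) (i<i′ , i~i′) ⟩
      on-edge i i′         ≤⟨ term≤sum (0≤on-edge i) i′ ⟩
      sum (on-edge i)      ≤⟨ term≤sum (λ k → sum-nonNegative (0≤on-edge k)) i ⟩
      sumEdges G f         ∎
      where
      on-edge : Fin m → Fin m → Carrier
      on-edge i i′ = if does (edge? i i′) then f i i′ else 0#
      selected : ∀ {A : Set} (a? : Dec A) {x} → A → x ≈ (if does a? then x else 0#)
      selected (yes _) a = ≈-refl
      selected (no ¬a) a = contradiction a ¬a
      nonneg : ∀ {A : Set} (a? : Dec A) {x} → (A → 0# ≤ x) → 0# ≤ (if does a? then x else 0#)
      nonneg (yes a) 0≤x = 0≤x a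
      nonneg (no _)  0≤x = ≤-refl
      0≤on-edge : ∀ k k′ → 0# ≤ on-edge k k′
      0≤on-edge k k′ = nonneg (edge? k k′) λ (k<k′ , k~k′) → 0≤f k<k′ k~k′

    E-cong : ∀ {f g} → (∀ {i i′} → i Fin.< i′ → i ~ i′ → f i i′ ≈ g i i′) → E f ≈ E g
    E-cong f≈g = sumEdges-cong λ i<i′ i~i′ → *-congˡ (f≈g i<i′ i~i′)

    E-mono : ∀ {f g} → (∀ {i i′} → i Fin.< i′ → i ~ i′ → f i i′ ≤ g i i′) → E f ≤ E g
    E-mono f≤g = sumEdges-mono λ i<i′ i~i′ → *-monoˡ-≤ (proj₁ (positive i~i′)) (f≤g i<i′ i~i′)

    E-linear : ∀ a f b g → E (λ i i′ → a * f i i′ + b * g i i′) ≈ a * E f + b * E g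
    E-linear a f b g = ≈-trans
      (sumEdges-cong λ {i} {i′} _ _ → solve 5 (λ p a x b y → p :* (a :* x :+ b :* y)
          := a :* (p :* x) :+ b :* (p :* y))
        ≈-refl (P i i′) a (f i i′) b (g i i′))
      (sumEdges-linear a (λ i i′ → P i i′ * f i i′) b (λ i i′ → P i i′ * g i i′))

    E-constant : ∀ c → E (λ _ _ → c) ≈ c
    E-constant c = begin-equality
      sumEdges G (λ i i′ → P i i′ * c)
        ≈⟨ sumEdges-cong (λ {i} {i′} _ _ → solve 2 (λ p c → p :* c
            := c :* p :+ con (+ 0) :* p) ≈-refl (P i i′) c) ⟩
      sumEdges G (λ i i′ → c * P i i′ + 0# * P i i′)
        ≈⟨ sumEdges-linear c P 0# P ⟩
      c * sumEdges G P + 0# * sumEdges G P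
        ≈⟨ +-cong (*-congˡ total) (zeroˡ _) ⟩
      c * 1# + 0#
        ≈⟨ solve 1 (λ c → c :* con (+ 1) :+ con (+ 0) := c) ≈-refl c ⟩
      c ∎

    E-scale : ∀ a f → E (λ i i′ → a * f i i′) ≈ a * E f
    E-scale a f = begin-equality
      E (λ i i′ → a * f i i′)
        ≈⟨ E-cong (λ {i} {i′} _ _ → solve 2 (λ a x → a :* x := a :* x :+ con (+ 0) :* x) ≈-refl a (f i i′)) ⟩
      E (λ i i′ → a * f i i′ + 0# * f i i′)
        ≈⟨ E-linear a f 0# f ⟩
      a * E f + 0# * E f
        ≈⟨ solve 2 (λ a x → a :* x :+ con (+ 0) :* x := a :* x) ≈-refl a (E f) ⟩
      a * E f ∎

    E-sum : ∀ {n} (f : Fin n → Fin m → Fin m → Carrier) →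
            E (λ i i′ → sum λ k → f k i i′) ≈ sum λ k → E (f k)
    E-sum {zero}  f = E-constant 0#
    E-sum {suc n} f = begin-equality
      E (λ i i′ → f zero i i′ + rest i i′)
        ≈⟨ E-cong (λ {i} {i′} _ _ → +-cong (≈-sym (*-identityˡ _)) (≈-sym (*-identityˡ _))) ⟩
      E (λ i i′ → 1# * f zero i i′ + 1# * rest i i′)
        ≈⟨ E-linear 1# (f zero) 1# rest ⟩
      1# * E (f zero) + 1# * E rest
        ≈⟨ +-cong (*-identityˡ _) (≈-trans (*-identityˡ _) (E-sum λ k → f (suc k))) ⟩
      E (f zero) + (sum λ k → E (f (suc k))) ∎
      where
      rest : Fin m → Fin m → Carrier
      rest i i′ = sum λ k → f (suc k) i i′

    W : Matrix m
    W = gossipMatrix G P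

    -- For i ≠ i′, the orthogonal projection onto the vectors with equal entries at i and i′; `half`
    -- is the inverse of the squared norm of eᵢ - eᵢ′.
    projection : Fin m → Fin m → Matrix m
    projection i i′ k l = δ k l - half * ((δ i k - δ i′ k) * (δ i l - δ i′ l))

    sum-δ-difference : ∀ i i′ (y : Vector Carrier m) → sum (λ l → (δ i l - δ i′ l) * y l) ≈ y i - y i′
    sum-δ-difference i i′ y = begin-equality
      sum (λ l → (δ i l - δ i′ l) * y l)
        ≈⟨ sum-cong (λ l → solve 3 (λ a b y → (a :- b) :* y
            := con (+ 1) :* (a :* y) :+ (:- con (+ 1)) :* (b :* y))
             ≈-refl (δ i l) (δ i′ l) (y l)) ⟩
      sum (λ l → 1# * (δ i l * y l) + - 1# * (δ i′ l * y l))
        ≈⟨ sum-linear 1# (λ l → δ i l * y l) (- 1#) (λ l → δ i′ l * y l) ⟩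
      1# * sum (λ l → δ i l * y l) + - 1# * sum (λ l → δ i′ l * y l)
        ≈⟨ +-cong (*-congˡ (sum-δ i y)) (*-congˡ (sum-δ i′ y)) ⟩
      1# * y i + - 1# * y i′
        ≈⟨ solve 2 (λ a b → con (+ 1) :* a :+ (:- con (+ 1)) :* b := a :- b) ≈-refl (y i) (y i′) ⟩
      y i - y i′ ∎

    projection▹ : ∀ i i′ y k →
      (projection i i′ ▹ y) k ≈ 1# * y k + - half * (y i - y i′) * (δ i k - δ i′ k)
    projection▹ i i′ y k = begin-equality
      sum (λ l → projection i i′ k l * y l)
        ≈⟨ sum-cong (λ l → solve 5 (λ d h u v y → (d :- h :* (u :* v)) :* y
            := con (+ 1) :* (d :* y) :+ (:- h :* u) :* (v :* y))
             ≈-refl (δ k l) half (δ i k - δ i′ k) (δ i l - δ i′ l) (y l)) ⟩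
      sum (λ l → 1# * (δ k l * y l) + (- half * D) * ((δ i l - δ i′ l) * y l))
        ≈⟨ sum-linear 1# (λ l → δ k l * y l) (- half * D) (λ l → (δ i l - δ i′ l) * y l) ⟩
      1# * sum (λ l → δ k l * y l) + (- half * D) * sum (λ l → (δ i l - δ i′ l) * y l)
        ≈⟨ +-cong (*-congˡ (sum-δ k y)) (*-congˡ (sum-δ-difference i i′ y)) ⟩
      1# * y k + (- half * D) * (y i - y i′)
        ≈⟨ +-congˡ (solve 3 (λ h d u → (:- h :* d) :* u := (:- h :* u) :* d) ≈-refl half D (y i - y i′)) ⟩
      1# * y k + - half * (y i - y i′) * D ∎
      where D = δ i k - δ i′ k

    ⟨,projection▹⟩ : ∀ i i′ x y → ⟨ x , projection i i′ ▹ y ⟩ ≈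
      ⟨ x , y ⟩ - half * ((x i - x i′) * (y i - y i′))
    ⟨,projection▹⟩ i i′ x y = begin-equality
      ⟨ x , projection i i′ ▹ y ⟩
        ≈⟨ ⟨⟩-cong (λ k → ≈-refl) (projection▹ i i′ y) ⟩
      ⟨ x , (λ k → 1# * y k + - half * (y i - y i′) * (δ i k - δ i′ k)) ⟩
        ≈⟨ ⟨⟩-linearʳ x 1# y (- half * (y i - y i′)) (λ k → δ i k - δ i′ k) ⟩
      1# * ⟨ x , y ⟩ + - half * (y i - y i′) * ⟨ x , (λ k → δ i k - δ i′ k) ⟩
        ≈⟨ +-congˡ (*-congˡ (≈-trans (⟨⟩-comm x _) (sum-δ-difference i i′ x))) ⟩
      1# * ⟨ x , y ⟩ + - half * (y i - y i′) * (x i - x i′)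
        ≈⟨ solve 4 (λ s h u v → con (+ 1) :* s :+ (:- h :* u) :* v
            := s :- h :* (v :* u)) ≈-refl ⟨ x , y ⟩ half (y i - y i′) (x i - x i′) ⟩
      ⟨ x , y ⟩ - half * ((x i - x i′) * (y i - y i′)) ∎

    -- Kept bilinear for two uses: x = y gives the expected energy, and x constant gives the column
    -- sums of W.
    ⟨,W▹⟩ : ∀ x y → ⟨ x , W ▹ y ⟩ ≈ E (λ i i′ → ⟨ x , y ⟩ - half * ((x i - x i′) * (y i - y i′)))
    ⟨,W▹⟩ x y = begin-equality
      sum (λ k → x k * sum λ l → W k l * y l)
        ≈⟨ sum-cong (λ k → *-congˡ (W▹ k)) ⟩
      sum (λ k → x k * E (λ i i′ → (projection i i′ ▹ y) k))
        ≈⟨ sum-cong (λ k → E-scale (x k) (λ i i′ → (projection i i′ ▹ y) k)) ⟨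
      sum (λ k → E (λ i i′ → x k * (projection i i′ ▹ y) k))
        ≈⟨ E-sum (λ k i i′ → x k * (projection i i′ ▹ y) k) ⟨
      E (λ i i′ → ⟨ x , projection i i′ ▹ y ⟩)
        ≈⟨ E-cong (λ {i} {i′} _ _ → ⟨,projection▹⟩ i i′ x y) ⟩
      E (λ i i′ → ⟨ x , y ⟩ - half * ((x i - x i′) * (y i - y i′))) ∎
      where
      W▹ : ∀ k → (W ▹ y) k ≈ E (λ i i′ → (projection i i′ ▹ y) k)
      W▹ k = begin-equality
        sum (λ l → W k l * y l)
          ≈⟨ sum-cong (λ l → ≈-trans (*-comm _ _) (≈-trans (≈-sym (E-scale (y l) (λ i i′ → projection i i′ k l)))
               (E-cong λ {i} {i′} _ _ → *-comm _ _))) ⟩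
        sum (λ l → E (λ i i′ → projection i i′ k l * y l))
          ≈⟨ E-sum (λ l i i′ → projection i i′ k l * y l) ⟨
        E (λ i i′ → (projection i i′ ▹ y) k) ∎

    W-sym : ∀ k l → W k l ≈ W l k
    W-sym k l = E-cong λ {i} {i′} _ _ → +-cong (δ-sym k l) (-‿cong (*-congˡ (*-comm _ _)))

    W-quadratic≤∥∥² : ∀ x → quadratic W x ≤ ∥ x ∥²
    W-quadratic≤∥∥² x = begin
      quadratic W x       ≈⟨ ⟨,W▹⟩ x x ⟩
      E (λ i i′ → ∥ x ∥² - half * ((x i - x i′) * (x i - x i′)))
        ≤⟨ E-mono (λ {i} {i′} _ _ → 0≤⇒≤ (*-nonNegative 0≤half (0≤x² (x i - x i′)))
             (solve 2 (λ n u → n :- u :+ u := n) ≈-refl ∥ x ∥² (half * ((x i - x i′) * (x i - x i′))))) ⟩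
      E (λ i i′ → ∥ x ∥²) ≈⟨ E-constant ∥ x ∥² ⟩
      ∥ x ∥²              ∎

    E-energy-step : ∀ {n} c (b : Scores m n) j →
      E (λ i i′ → energy c (step (i , i′) b) j) ≈ quadratic W (deviation c b j)
    E-energy-step c b j = ≈-trans
      (E-cong λ {i} {i′} i<i′ _ → energy-step (Fin.<⇒≢ i<i′) c b j)
      (≈-sym (⟨,W▹⟩ (deviation c b j) (deviation c b j)))

    -- The form is an expected energy: that after one step from the scores `x` for a single object,
    -- about the centre 0.
    0≤W-quadratic : ∀ x → 0# ≤ quadratic W x
    0≤W-quadratic x = begin
      0#                   ≈⟨ E-constant 0# ⟨
      E (λ _ _ → 0#)       ≤⟨ E-mono (λ {i} {i′} _ _ → 0≤∥∥² (deviation 0# (step (i , i′) b) zero)) ⟩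
      E (λ i i′ → energy 0# (step (i , i′) b) zero) ≈⟨ E-energy-step 0# b zero ⟩
      quadratic W (deviation 0# b zero)
        ≈⟨ ⟨⟩-cong x-0≈x (λ k → ⟨⟩-cong (λ l → ≈-refl {W k l}) x-0≈x) ⟩
      quadratic W x        ∎
      where
      b : Scores m 1
      b l _ = x l
      x-0≈x : ∀ l → x l - 0# ≈ x l
      x-0≈x l = solve 1 (λ x → x :- con (+ 0) := x) ≈-refl (x l)

    ⟨1,⟩≈sum : ∀ (x : Vector Carrier m) → ⟨ (λ _ → 1#) , x ⟩ ≈ sum x
    ⟨1,⟩≈sum x = sum-cong {f = λ k → 1# * x k} λ k → *-identityˡ (x k)

    sum-W▹ : ∀ x → sum (W ▹ x) ≈ sum x
    sum-W▹ x = begin-equality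
      sum (W ▹ x)
        ≈⟨ ⟨1,⟩≈sum (W ▹ x) ⟨
      ⟨ (λ _ → 1#) , W ▹ x ⟩
        ≈⟨ ⟨,W▹⟩ (λ _ → 1#) x ⟩
      E (λ i i′ → ⟨ (λ _ → 1#) , x ⟩ - half * ((1# - 1#) * (x i - x i′)))
        ≈⟨ E-cong (λ {i} {i′} _ _ → ≈-trans
             (solve 3 (λ s h u → s :- h :* ((con (+ 1) :- con (+ 1)) :* u)
                 := s) ≈-refl ⟨ (λ _ → 1#) , x ⟩ half (x i - x i′))
             (⟨1,⟩≈sum x)) ⟩
      E (λ _ _ → sum x)
        ≈⟨ E-constant (sum x) ⟩
      sum x ∎

    -- By symmetry the row sums of W are its column sums. The right-hand side has the shape
    -- `μ * v k` that `Eigenvector` asks for, with μ = 1.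
    W▹1 : ∀ k → (W ▹ λ _ → 1#) k ≈ 1# * 1#
    W▹1 k = begin-equality
      (W ▹ λ _ → 1#) k      ≈⟨ sum-δ k (W ▹ λ _ → 1#) ⟨
      ⟨ δ k , W ▹ (λ _ → 1#) ⟩ ≈⟨ ▹-comm W-sym (δ k) (λ _ → 1#) ⟩
      ⟨ (λ _ → 1#) , W ▹ δ k ⟩ ≈⟨ ⟨1,⟩≈sum (W ▹ δ k) ⟩
      sum (W ▹ δ k)         ≈⟨ sum-W▹ (δ k) ⟩
      sum (δ k)             ≈⟨ sum-cong {f = λ l → δ k l * 1#} (λ l → *-identityʳ (δ k l)) ⟨
      sum (λ l → δ k l * 1#) ≈⟨ sum-δ k (λ _ → 1#) ⟩
      1#                    ≈⟨ *-identityˡ 1# ⟨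
      1# * 1#               ∎

-- The gossip matrix on vectors of sum 0.

module SecondEigenvalue (ℝ : CompleteOrderedField) where

  open OrderedField ℝ
  open QuadraticForms ℝ
  open GossipStep ℝ
  open ≤-Reasoning

  module _ {m} .{{_ : NonZero m}}
    (G : Graph m) (P : Fin m → Fin m → Carrier) (isDist : IsEdgeDistribution G P) where

    open EdgeDistribution G P isDist

    -- Applied to `λ₂`, this allows multiplying inequalities by its powers, and makes every
    -- eigenvalue above it positive, as `deflated-eigenvector-sum` requires.
    0≤eigenvalue : ∀ {μ} → Eigenvalue W μ → 0# ≤ μ
    0≤eigenvalue {μ} (v , v≉0 , W▹v≈μv) = *-cancelˡ-≤ (≉0⇒0<∥∥² v≉0) (begin
      ∥ v ∥² * 0#                    ≈⟨ zeroʳ _ ⟩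
      0#                             ≤⟨ 0≤W-quadratic v ⟩
      ⟨ v , W ▹ v ⟩                  ≈⟨ ⟨⟩-cong (λ k → ≈-refl) (λ k → ≈-trans (W▹v≈μv k)
        (solve 2 (λ μ x → μ :* x := μ :* x :+ con (+ 0) :* x) ≈-refl μ (v k))) ⟩
      ⟨ v , (λ k → μ * v k + 0# * v k) ⟩ ≈⟨ ⟨⟩-linearʳ v μ v 0# v ⟩
      μ * ∥ v ∥² + 0# * ∥ v ∥²       ≈⟨ solve 2 (λ μ n → μ :* n :+ con (+ 0) :* n := n :* μ) ≈-refl μ ∥ v ∥² ⟩
      ∥ v ∥² * μ                     ∎)

    two-eigenvalues : ∀ {μ λ₂ x} → sum x ≈ 0# → (∃ λ k → ¬ (x k ≈ 0#)) → (∀ k → (W ▹ x) k ≈ μ * x k) →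
                      λ₂ < 1# → λ₂ < μ → AtLeastEigenvalues 2 W (λ₂ <_)
    two-eigenvalues {μ} {λ₂} {x} Σx≈0 (k , xₖ≉0) W▹x≈μx λ₂<1 λ₂<μ =
      1# ∷ μ ∷ [] , (λ _ → 1#) ∷ x ∷ [] , independent ,
      (λ { zero       → (k , λ 1≈0 → 0≉1 (≈-sym 1≈0)) , W▹1
         ; (suc zero) → (k , xₖ≉0) , W▹x≈μx }) ,
      (λ { zero → λ₂<1 ; (suc zero) → λ₂<μ })
      where
      independent : LinearlyIndependent ((λ _ → 1#) ∷ x ∷ [])
      independent c c₀+c₁x≈0 = λ { zero → c₀≈0 ; (suc zero) → c₁≈0 }
        where
        c₀ = c zero
        c₁ = c (suc zero)
        -- Summing the relation over all coordinates removes `x`, whose sum is 0, and leaves m c₀.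
        c₀≈0 : c₀ ≈ 0#
        c₀≈0 = x*y≈0⇒y≈0 (>⇒≉ (0<n·1 m)) (begin-equality
          m · 1# * c₀
            ≈⟨ solve 3 (λ n a b → n :* a := a :* (n :* con (+ 1)) :+ b :* con (+ 0)) ≈-refl (m · 1#) c₀ c₁ ⟩
          c₀ * (m · 1# * 1#) + c₁ * 0#
            ≈⟨ +-cong (*-congˡ (sum-constant m 1#)) (*-congˡ Σx≈0) ⟨
          c₀ * sum {m} (λ _ → 1#) + c₁ * sum x
            ≈⟨ sum-linear c₀ (λ _ → 1#) c₁ x ⟨
          sum (λ l → c₀ * 1# + c₁ * x l)
            ≈⟨ sum-zero (λ l → ≈-trans (+-congˡ (≈-sym (+-identityʳ _))) (c₀+c₁x≈0 l)) ⟩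
          0# ∎)
        c₁≈0 : c₁ ≈ 0#
        c₁≈0 = x*y≈0⇒y≈0 xₖ≉0 (begin-equality
          x k * c₁
            ≈⟨ solve 2 (λ x b → x :* b := con (+ 0) :* con (+ 1) :+ (b :* x :+ con (+ 0))) ≈-refl (x k) c₁ ⟩
          0# * 1# + (c₁ * x k + 0#) ≈⟨ +-congʳ (*-congʳ c₀≈0) ⟨
          c₀ * 1# + (c₁ * x k + 0#) ≈⟨ c₀+c₁x≈0 k ⟩
          0# ∎)

    -- Subtracting the all-ones matrix moves the eigenvalue 1 of the constant
    -- vectors to 1 − m ≤ 0 and leaves W unchanged on their complement.
    deflated : Matrix m
    deflated k l = W k l - 1#

    deflated▹ : ∀ x k → (deflated ▹ x) k ≈ 1# * (W ▹ x) k + - sum x * 1#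
    deflated▹ x k = begin-equality
      sum (λ l → (W k l - 1#) * x l)
        ≈⟨ sum-cong (λ l → solve 2 (λ w x → (w :- con (+ 1)) :* x
            := con (+ 1) :* (w :* x) :+ (:- con (+ 1)) :* x)
             ≈-refl (W k l) (x l)) ⟩
      sum (λ l → 1# * (W k l * x l) + - 1# * x l)
        ≈⟨ sum-linear 1# (λ l → W k l * x l) (- 1#) x ⟩
      1# * (W ▹ x) k + - 1# * sum x
        ≈⟨ +-congˡ (solve 1 (λ s → (:- con (+ 1)) :* s := (:- s) :* con (+ 1)) ≈-refl (sum x)) ⟩
      1# * (W ▹ x) k + - sum x * 1# ∎

    deflated-quadratic : ∀ x → quadratic deflated x ≈ quadratic W x - sum x * sum x
    deflated-quadratic x = begin-equality
      quadratic deflated x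
        ≈⟨ ⟨⟩-cong (λ k → ≈-refl) (deflated▹ x) ⟩
      ⟨ x , (λ k → 1# * (W ▹ x) k + - sum x * 1#) ⟩
        ≈⟨ ⟨⟩-linearʳ x 1# (W ▹ x) (- sum x) (λ _ → 1#) ⟩
      1# * quadratic W x + - sum x * ⟨ x , (λ _ → 1#) ⟩
        ≈⟨ +-congˡ (*-congˡ (≈-trans (⟨⟩-comm x (λ _ → 1#)) (⟨1,⟩≈sum x))) ⟩
      1# * quadratic W x + - sum x * sum x
        ≈⟨ solve 2 (λ q s → con (+ 1) :* q :+ (:- s) :* s := q :- s :* s) ≈-refl (quadratic W x) (sum x) ⟩
      quadratic W x - sum x * sum x ∎

    -- W preserves sums, so adding up the eigenvector equation gives (1 - m) s = μ s for the sum s,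
    -- and μ + (m - 1) is positive.
    deflated-eigenvector-sum : ∀ {μ x} → 0# < μ → (∀ k → (deflated ▹ x) k ≈ μ * x k) → sum x ≈ 0#
    deflated-eigenvector-sum {μ} {x} 0<μ eigen = x*y≈0⇒y≈0 (>⇒≉ 0<μ+[m-1]) (begin-equality
      (μ + (m · 1# - 1#)) * s
        ≈⟨ solve 3 (λ μ n s → (μ :+ (n :- con (+ 1))) :* s
            := μ :* s :+ con (+ 0) :* s :- (con (+ 1) :* s :+ (:- s) :* (n :* con (+ 1))))
             ≈-refl μ (m · 1#) s ⟩
      μ * s + 0# * s - (1# * s + - s * (m · 1# * 1#))
        ≈⟨ +-cong (≈-sym (sum-linear μ x 0# x)) (-‿cong (≈-sym (+-cong (*-congˡ (sum-W▹ x)) (*-congˡ (sum-constant m 1#))))) ⟩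
      sum (λ k → μ * x k + 0# * x k) - (1# * sum (W ▹ x) + - s * sum {m} (λ _ → 1#))
        ≈⟨ +-congˡ (-‿cong (sum-linear 1# (W ▹ x) (- s) (λ _ → 1#))) ⟨
      sum (λ k → μ * x k + 0# * x k) - sum (λ k → 1# * (W ▹ x) k + - s * 1#)
        ≈⟨ +-congʳ (sum-cong λ k → ≈-trans (solve 2 (λ μ x → μ :* x :+ con (+ 0) :* x := μ :* x) ≈-refl μ (x k))
             (≈-trans (≈-sym (eigen k)) (deflated▹ x k))) ⟩
      sum (λ k → 1# * (W ▹ x) k + - s * 1#) - sum (λ k → 1# * (W ▹ x) k + - s * 1#)
        ≈⟨ -‿inverseʳ _ ⟩
      0# ∎)
      where
      s = sum x
      0<μ+[m-1] : 0# < μ + (m · 1# - 1#)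
      0<μ+[m-1] = <-≤-trans 0<μ (0≤⇒≤ (≤⇒0≤ (1≤n·1 m)) ≈-refl)

    -- At a vector `y` of sum 0 the forms of W and `deflated` agree, so a violation at `y` pushes
    -- the top eigenvalue μ of `deflated` above `λ₂`. Its eigenvector has sum 0 and is thus an
    -- eigenvector of W as well, independent of the constants.
    W-contraction : ∀ {λ₂} → IsKthLargestEigenvalue 2 W λ₂ →
                    ∀ {y} → sum y ≈ 0# → quadratic W y ≤ λ₂ * ∥ y ∥²
    W-contraction {λ₂} (λ₂-eigen , _ , ¬two-above) {y} Σy≈0 with 1# ≤? λ₂ | quadratic W y ≤? λ₂ * ∥ y ∥²
    ... | _         | yes q≤λ₂n = q≤λ₂n
    ... | yes 1≤λ₂ | no  _     = begin
      quadratic W y  ≤⟨ W-quadratic≤∥∥² y ⟩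
      ∥ y ∥²         ≈⟨ *-identityʳ _ ⟨
      ∥ y ∥² * 1#    ≤⟨ *-monoˡ-≤ (0≤∥∥² y) 1≤λ₂ ⟩
      ∥ y ∥² * λ₂    ≈⟨ *-comm _ _ ⟩
      λ₂ * ∥ y ∥²    ∎
    ... | no  1≰λ₂ | no  q≰λ₂n with ∥∥²≈0⊎0<∥∥² y
    ...   | inj₁ n≈0 = begin
      quadratic W y  ≤⟨ W-quadratic≤∥∥² y ⟩
      ∥ y ∥²         ≈⟨ n≈0 ⟩
      0#             ≈⟨ zeroʳ λ₂ ⟨
      λ₂ * 0#        ≈⟨ *-congˡ n≈0 ⟨
      λ₂ * ∥ y ∥²    ∎
    ...   | inj₂ 0<n = contradiction
      (two-eigenvalues Σx≈0 (0<∥∥²⇒≉0 0<∥x∥²) W▹x≈μx (≰⇒> 1≰λ₂) λ₂<μ) ¬two-above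
      where
      deflated≤1 : ∀ x → quadratic deflated x ≤ 1# * ∥ x ∥²
      deflated≤1 x = begin
        quadratic deflated x          ≈⟨ deflated-quadratic x ⟩
        quadratic W x - sum x * sum x ≤⟨ 0≤⇒≤ (0≤x² (sum x)) (solve 2 (λ q s → q :- s :+ s
            := q) ≈-refl (quadratic W x) (sum x * sum x)) ⟩
        quadratic W x                 ≤⟨ W-quadratic≤∥∥² x ⟩
        ∥ x ∥²                        ≈⟨ *-identityˡ _ ⟨
        1# * ∥ x ∥²                   ∎
      top = max-eigenvector deflated (λ k l → +-congʳ (W-sym k l)) deflated≤1 {y} 0<n
      μ = proj₁ top
      x = proj₁ (proj₂ top)
      0<∥x∥² = proj₁ (proj₂ (proj₂ top))
      eigen : ∀ k → (deflated ▹ x) k ≈ μ * x k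
      eigen = proj₁ (proj₂ (proj₂ (proj₂ top)))
      λ₂<μ : λ₂ < μ
      λ₂<μ = ≰⇒> λ μ≤λ₂ → q≰λ₂n (begin
        quadratic W y                 ≈⟨ solve 1 (λ q → q := q :- con (+ 0) :* con (+ 0)) ≈-refl _ ⟩
        quadratic W y - 0# * 0#       ≈⟨ +-congˡ (-‿cong (*-cong Σy≈0 Σy≈0)) ⟨
        quadratic W y - sum y * sum y ≈⟨ deflated-quadratic y ⟨
        quadratic deflated y          ≤⟨ proj₂ (proj₂ (proj₂ (proj₂ top))) y ⟩
        μ * ∥ y ∥²                    ≈⟨ *-comm _ _ ⟩
        ∥ y ∥² * μ                    ≤⟨ *-monoˡ-≤ (0≤∥∥² y) μ≤λ₂ ⟩
        ∥ y ∥² * λ₂                   ≈⟨ *-comm _ _ ⟩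
        λ₂ * ∥ y ∥²                   ∎)
      Σx≈0 : sum x ≈ 0#
      Σx≈0 = deflated-eigenvector-sum (≤-<-trans (0≤eigenvalue λ₂-eigen) λ₂<μ) eigen
      W▹x≈μx : ∀ k → (W ▹ x) k ≈ μ * x k
      W▹x≈μx k = begin-equality
        (W ▹ x) k                      ≈⟨ solve 1 (λ w → w
            := con (+ 1) :* w :+ (:- con (+ 0)) :* con (+ 1)) ≈-refl _ ⟩
        1# * (W ▹ x) k + - 0# * 1#     ≈⟨ +-congˡ (*-congʳ (-‿cong Σx≈0)) ⟨
        1# * (W ▹ x) k + - sum x * 1#  ≈⟨ deflated▹ x k ⟨
        (deflated ▹ x) k               ≈⟨ eigen k ⟩
        μ * x k                        ∎

-- Expectation over sequences of edges, and decay of the energy.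

module TailBound (ℝ : CompleteOrderedField) where

  open OrderedField ℝ
  open QuadraticForms ℝ
  open GossipStep ℝ
  open SecondEigenvalue ℝ
  open ≤-Reasoning
  open import Algebra.Construct.NaturalChoice.Min totalOrder using (x⊓y≤x; x⊓y≤y; ⊓-glb)
  open import Algebra.Properties.Semiring.Mult semiring using (×-congʳ; ×-assoc-*; ×-comm-*; ×1-homo-*)
  open import Relation.Binary.Construct.Add.Supremum.NonStrict _≤_ using (≤⁺-trans; [_]; _≤⊤⁺; [≤]-injective)

  indicator-mono : ∀ {A : Set} (a? : Dec A) {x} → 0# ≤ x → (A → 1# ≤ x) → indicator a? ≤ x
  indicator-mono (yes a) 0≤x 1≤x = 1≤x a
  indicator-mono (no _)  0≤x 1≤x = 0≤x

  0≤indicator : ∀ {A : Set} (a? : Dec A) → 0# ≤ indicator a?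
  0≤indicator (yes _) = 0≤1
  0≤indicator (no _)  = ≤-refl

  indicator-yes : ∀ {A : Set} (a? : Dec A) → A → indicator a? ≈ 1#
  indicator-yes (yes _) a = ≈-refl
  indicator-yes (no ¬a) a = contradiction a ¬a

  module _ {m} (G : Graph m) (P : Fin m → Fin m → Carrier) (isDist : IsEdgeDistribution G P) where

    open Graph G
    open IsEdgeDistribution isDist
    open EdgeDistribution G P isDist

    Path : ℕ → Set
    Path = Vec (Fin m × Fin m)

    𝔼 : ∀ t → (Path t → Carrier) → Carrier
    𝔼 = expectation G P

    𝔼-mono : ∀ t {f g} → (∀ es → f es ≤ g es) → 𝔼 t f ≤ 𝔼 t g
    𝔼-mono zero    f≤g = f≤g Vec.[]
    𝔼-mono (suc t) f≤g = E-mono λ {i} {i′} _ _ → 𝔼-mono t λ es → f≤g ((i , i′) Vec.∷ es)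

    𝔼-scale : ∀ t a f → 𝔼 t (λ es → a * f es) ≈ a * 𝔼 t f
    𝔼-scale zero    a f = ≈-refl
    𝔼-scale (suc t) a f = ≈-trans
      (E-cong λ {i} {i′} _ _ → 𝔼-scale t a (λ es → f ((i , i′) Vec.∷ es)))
      (E-scale a (λ i i′ → 𝔼 t (λ es → f ((i , i′) Vec.∷ es))))

    𝔼-sum : ∀ t {n} (f : Fin n → Path t → Carrier) → 𝔼 t (λ es → sum λ j → f j es) ≈ sum λ j → 𝔼 t (f j)
    𝔼-sum zero    f = ≈-refl
    𝔼-sum (suc t) f = ≈-trans
      (E-cong λ {i} {i′} _ _ → 𝔼-sum t (λ j es → f j ((i , i′) Vec.∷ es)))
      (E-sum λ j i i′ → 𝔼 t (λ es → f j ((i , i′) Vec.∷ es)))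

    𝔼-nonNegative : ∀ t {f} → (∀ es → 0# ≤ f es) → 0# ≤ 𝔼 t f
    𝔼-nonNegative zero    0≤f = 0≤f Vec.[]
    𝔼-nonNegative (suc t) 0≤f = ≤-trans (≤-reflexive (≈-sym (E-constant 0#)))
      (E-mono λ {i} {i′} _ _ → 𝔼-nonNegative t λ es → 0≤f ((i , i′) Vec.∷ es))

    -- Every edge has positive probability, so a nonnegative `f` of expectation 0 is 0 on all
    -- sequences of edges. The conclusion is about `g` because `f` may be positive on sequences of
    -- pairs that are not edges, which the expectation ignores.
    𝔼≤0 : ∀ t {f g} → (∀ es → 0# ≤ f es) → (∀ es → f es ≤ 0# → g es ≤ 0#) → 𝔼 t f ≤ 0# → 𝔼 t g ≤ 0#
    𝔼≤0 zero    0≤f f≤0⇒g≤0 𝔼f≤0 = f≤0⇒g≤0 Vec.[] 𝔼f≤0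
    𝔼≤0 (suc t) {f} {g} 0≤f f≤0⇒g≤0 𝔼f≤0 = ≤-trans (E-mono 𝔼g≤0) (≤-reflexive (E-constant 0#))
      where
      𝔼f : Fin m → Fin m → Carrier
      𝔼f i i′ = 𝔼 t (λ es → f ((i , i′) Vec.∷ es))
      0≤𝔼f : ∀ i i′ → 0# ≤ 𝔼f i i′
      0≤𝔼f i i′ = 𝔼-nonNegative t λ es → 0≤f ((i , i′) Vec.∷ es)
      𝔼g≤0 : ∀ {i i′} → i Fin.< i′ → i ~ i′ → 𝔼 t (λ es → g ((i , i′) Vec.∷ es)) ≤ 0#
      𝔼g≤0 {i} {i′} i<i′ i~i′ = 𝔼≤0 t (λ es → 0≤f _) (λ es → f≤0⇒g≤0 _)
        (*-cancelˡ-≤ (positive i~i′) (begin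
          P i i′ * 𝔼f i i′
            ≤⟨ edge≤sumEdges (λ {k} {k′} _ k~k′ → *-nonNegative (proj₁ (positive k~k′)) (0≤𝔼f k k′)) i<i′ i~i′ ⟩
          sumEdges G (λ i i′ → P i i′ * 𝔼f i i′)
            ≤⟨ 𝔼f≤0 ⟩
          0#
            ≈⟨ zeroʳ _ ⟨
          P i i′ * 0# ∎))

    final : ∀ {n t} → Scores m n → Path t → Scores m n
    final {t = t} b es = scoresAt b es (fromℕ t)

    module _ .{{_ : NonZero m}} {λ₂} (λ₂-second : IsKthLargestEigenvalue 2 W λ₂) where

      0≤λ₂ : 0# ≤ λ₂
      0≤λ₂ = 0≤eigenvalue G P isDist (proj₁ λ₂-second)

      energy-decay : ∀ t {n} c (b : Scores m n) j → sum (deviation c b j) ≈ 0# →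
                     𝔼 t (λ es → energy c (final b es) j) ≤ λ₂ ^ t * energy c b j
      energy-decay zero    c b j Σ≈0 = ≤-reflexive (≈-sym (*-identityˡ _))
      energy-decay (suc t) c b j Σ≈0 = begin
        E (λ i i′ → 𝔼 t (λ es → energy c (final (step (i , i′) b) es) j))
          ≤⟨ E-mono (λ {i} {i′} i<i′ _ → energy-decay t c (step (i , i′) b) j
               (≈-trans (sum-deviation-step (Fin.<⇒≢ i<i′) c b j) Σ≈0)) ⟩
        E (λ i i′ → λ₂ ^ t * energy c (step (i , i′) b) j)
          ≈⟨ E-scale (λ₂ ^ t) (λ i i′ → energy c (step (i , i′) b) j) ⟩
        λ₂ ^ t * E (λ i i′ → energy c (step (i , i′) b) j)
          ≈⟨ *-congˡ (E-energy-step c b j) ⟩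
        λ₂ ^ t * quadratic W (deviation c b j)
          ≤⟨ *-monoˡ-≤ (0≤^ 0≤λ₂ t) (W-contraction G P isDist λ₂-second Σ≈0) ⟩
        λ₂ ^ t * (λ₂ * energy c b j)
          ≈⟨ solve 3 (λ a l e → a :* (l :* e) := l :* a :* e) ≈-refl (λ₂ ^ t) λ₂ (energy c b j) ⟩
        λ₂ ^ suc t * energy c b j ∎

  -- The initial energy in terms of the spread.

  maximum-upper : ∀ {m} .{{_ : NonZero m}} (v : Vector Carrier m) i → v i ≤ maximum v
  maximum-upper {suc m} v zero    = Extrema.⊥≤max totalOrder (v zero) (List.tabulate (tail v))
  maximum-upper {suc m} v (suc i) = tabulate⁻ (Extrema.xs≤max totalOrder (v zero) _) i

  minimum-lower : ∀ {m} .{{_ : NonZero m}} (v : Vector Carrier m) i → minimum v ≤ v i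
  minimum-lower {suc m} v zero    = Extrema.min≤⊤ totalOrder (v zero) (List.tabulate (tail v))
  minimum-lower {suc m} v (suc i) = tabulate⁻ (Extrema.min≤xs totalOrder (v zero) _) i

  sum-deviation-average : ∀ {m n} .{{_ : NonZero m}} (b : Scores m n) j → sum (deviation (average b j) b j) ≈ 0#
  sum-deviation-average {m} b j = begin-equality
    sum (λ i → b i j - c)
      ≈⟨ sum-cong (λ i → solve 2 (λ x c → x :- c := con (+ 1) :* x :+ (:- c) :* con (+ 1)) ≈-refl (b i j) c) ⟩
    sum (λ i → 1# * b i j + - c * 1#)
      ≈⟨ sum-linear 1# (λ i → b i j) (- c) (λ _ → 1#) ⟩
    1# * s + - c * sum {m} (λ _ → 1#)
      ≈⟨ +-congˡ (*-congˡ (sum-constant m 1#)) ⟩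
    1# * s + - ((m · 1#) ⁻¹ * s) * (m · 1# * 1#)
      ≈⟨ solve 3 (λ s r n → con (+ 1) :* s :+ (:- (r :* s)) :* (n :* con (+ 1)) := s :- (r :* n) :* s)
           ≈-refl s ((m · 1#) ⁻¹) (m · 1#) ⟩
    s - ((m · 1#) ⁻¹ * m · 1#) * s
      ≈⟨ +-congˡ (-‿cong (*-congʳ (⁻¹-inverseˡ (>⇒≉ (0<n·1 m))))) ⟩
    s - 1# * s
      ≈⟨ solve 1 (λ s → s :- con (+ 1) :* s := con (+ 0)) ≈-refl s ⟩
    0# ∎
    where
    c = average b j
    s = sum (λ i → b i j)

  -- Among all centres the average gives the least energy, so it suffices
  -- to bound the energy about the minimal score.
  energy≤spread² : ∀ {m n} .{{_ : NonZero m}} (b : Scores m n) j →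
                   energy (average b j) b j ≤ m · 1# * (spread b j * spread b j)
  energy≤spread² {m} b j = begin
    energy c b j
      ≈⟨ solve 2 (λ e k → e := con (+ 1) :* e :+ k :* con (+ 0)) ≈-refl (energy c b j) k ⟩
    1# * energy c b j + k * 0#
      ≈⟨ +-congˡ (*-congˡ (sum-deviation-average b j)) ⟨
    1# * energy c b j + k * sum (deviation c b j)
      ≈⟨ sum-linear 1# (λ i → (b i j - c) * (b i j - c)) k (deviation c b j) ⟨
    sum (λ i → 1# * ((b i j - c) * (b i j - c)) + k * (b i j - c))
      ≤⟨ sum-mono-≤ (λ i → ≤-trans (0≤⇒≤ (0≤x² (c - lo))
           (solve 3 (λ x c l → con (+ 1) :* ((x :- c) :* (x :- c)) :+ (c :- l :+ (c :- l)) :* (x :- c) :+ (c :- l) :* (c :- l)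
             := (x :- l) :* (x :- l)) ≈-refl (b i j) c lo)) (square≤ i)) ⟩
    sum {m} (λ i → d * d)
      ≈⟨ sum-constant m (d * d) ⟩
    m · 1# * (d * d) ∎
    where
    c = average b j
    hi = maximum (λ i → b i j)
    lo = minimum (λ i → b i j)
    d = spread b j
    k = c - lo + (c - lo)
    square≤ : ∀ i → (b i j - lo) * (b i j - lo) ≤ d * d
    square≤ i = 0≤⇒≤ (+-nonNegative (*-nonNegative 0≤hi-x (+-nonNegative 0≤x-lo 0≤x-lo)) (0≤x² (hi - b i j)))
      (solve 3 (λ x l h → (x :- l) :* (x :- l) :+ ((h :- x) :* (x :- l :+ (x :- l)) :+ (h :- x) :* (h :- x))
          := (h :- l) :* (h :- l))
        ≈-refl (b i j) lo hi)
      where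
      0≤hi-x : 0# ≤ hi - b i j
      0≤hi-x = ≤⇒0≤ (maximum-upper (λ i → b i j) i)
      0≤x-lo : 0# ≤ b i j - lo
      0≤x-lo = ≤⇒0≤ (minimum-lower (λ i → b i j) i)

  -- Gaps of the average, and when small energies imply consensus.

  gapAbove≤ : ∀ {n} {v : Vector Carrier n} → Ordered v → ∀ {j k} → j Fin.< k → gapAbove v j ≤⁺ [ v k - v j ]
  gapAbove≤ {n} v↑ {j} {k} j<k with suc (toℕ j) ℕ.<? n
  ... | yes j+1<n = [ +-monoˡ-≤ _ (v↑ _ k (ℕ.≤-trans (ℕ.≤-reflexive (Fin.toℕ-fromℕ< j+1<n)) j<k)) ]
  ... | no  j+1≮n = contradiction (ℕ.≤-<-trans j<k (Fin.toℕ<n k)) j+1≮n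

  gapBelow≤ : ∀ {n} {v : Vector Carrier n} → Ordered v → ∀ {j k} → j Fin.< k → gapBelow v k ≤⁺ [ v k - v j ]
  gapBelow≤ {v = v} v↑ {j} {suc k} (ℕ.s≤s j≤k) = [ 0≤⇒≤
    (≤⇒0≤ (v↑ j (inject₁ k) (ℕ.≤-trans j≤k (ℕ.≤-reflexive (≡.sym (Fin.toℕ-inject₁ k))))))
    (solve 3 (λ x y z → x :- y :+ (y :- z) := x :- z) ≈-refl (v (suc k)) (v (inject₁ k)) (v j)) ]

  0≤gapAbove : ∀ {n} {v : Vector Carrier n} → Ordered v → ∀ j → [ 0# ] ≤⁺ gapAbove v j
  0≤gapAbove {n} v↑ j with suc (toℕ j) ℕ.<? n
  ... | yes j+1<n = [ ≤⇒0≤ (v↑ j _ (ℕ.≤-trans (ℕ.n≤1+n _) (ℕ.≤-reflexive (≡.sym (Fin.toℕ-fromℕ< j+1<n))))) ]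
  ... | no  _     = _ ≤⊤⁺

  0≤gapBelow : ∀ {n} {v : Vector Carrier n} → Ordered v → ∀ j → [ 0# ] ≤⁺ gapBelow v j
  0≤gapBelow v↑ zero    = _ ≤⊤⁺
  0≤gapBelow v↑ (suc j) = [ ≤⇒0≤ (v↑ (inject₁ j) (suc j)
    (ℕ.≤-trans (ℕ.≤-reflexive (Fin.toℕ-inject₁ j)) (ℕ.n≤1+n _))) ]

  ≤⁺-refl : ∀ {x} → x ≤⁺ x
  ≤⁺-refl {[ x ]} = [ ≤-refl ]
  ≤⁺-refl {⊤⁺}    = _ ≤⊤⁺

  x⊓⁺y≤x : ∀ x y → (x ⊓⁺ y) ≤⁺ x
  x⊓⁺y≤x [ x ] [ y ] = [ x⊓y≤x x y ]
  x⊓⁺y≤x [ x ] ⊤⁺    = ≤⁺-refl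
  x⊓⁺y≤x ⊤⁺    y     = _ ≤⊤⁺

  x⊓⁺y≤y : ∀ x y → (x ⊓⁺ y) ≤⁺ y
  x⊓⁺y≤y [ x ] [ y ] = [ x⊓y≤y x y ]
  x⊓⁺y≤y [ x ] ⊤⁺    = _ ≤⊤⁺
  x⊓⁺y≤y ⊤⁺    y     = ≤⁺-refl

  ⊓⁺-glb : ∀ {x y z} → x ≤⁺ y → x ≤⁺ z → x ≤⁺ (y ⊓⁺ z)
  ⊓⁺-glb [ x≤y ] [ x≤z ]  = [ ⊓-glb x≤y x≤z ]
  ⊓⁺-glb [ x≤y ] (_ ≤⊤⁺)  = [ x≤y ]
  ⊓⁺-glb (_ ≤⊤⁺) x≤z      = x≤z

  -- As `v` is ordered, the gap to the next object is the smallest one on that side, so the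
  -- separation bounds the distance to every later object.
  separation≤ˡ : ∀ {n} {v : Vector Carrier n} → Ordered v → ∀ {j k} → j Fin.< k → separation v j ≤⁺ [ v k - v j ]
  separation≤ˡ {v = v} v↑ {j} j<k = ≤⁺-trans ≤-trans (x⊓⁺y≤x (gapAbove v j) (gapBelow v j)) (gapAbove≤ v↑ j<k)

  separation≤ʳ : ∀ {n} {v : Vector Carrier n} → Ordered v → ∀ {j k} → j Fin.< k → separation v k ≤⁺ [ v k - v j ]
  separation≤ʳ {v = v} v↑ {k = k} j<k = ≤⁺-trans ≤-trans (x⊓⁺y≤y (gapAbove v k) (gapBelow v k)) (gapBelow≤ v↑ j<k)

  0≤separation : ∀ {n} {v : Vector Carrier n} → Ordered v → ∀ j → [ 0# ] ≤⁺ separation v j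
  0≤separation v↑ j = ⊓⁺-glb (0≤gapAbove v↑ j) (0≤gapBelow v↑ j)

  -- The energy exceeds (r/2)², with no square root or division. The inequality is strict because
  -- deviations of exactly half a gap leave the order intact. Infinite separation means a single
  -- object, which cannot be out of order.
  Far : Carrier ⁺ → Carrier → Set
  Far [ r ] e = r * r < 4 · e
  Far ⊤⁺    e = ⊥

  far? : ∀ r e → Dec (Far r e)
  far? [ r ] e with 4 · e ≤? r * r
  ... | yes 4e≤r² = no λ r²<4e → <⇒≱ r²<4e 4e≤r²
  ... | no  4e≰r² = yes (≰⇒> 4e≰r²)
  far? ⊤⁺    e = no λ ()

  -- From (2y)² ≤ 4e ≤ r² and r ≥ 0. Being one-sided, it needs no absolute value: `y` will be the
  -- deviation of the lower object and the negated deviation of the upper one.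
  ¬far⇒close : ∀ {r e d y} → ¬ Far r e → [ 0# ] ≤⁺ r → r ≤⁺ [ d ] → y * y ≤ e → y + y ≤ d
  ¬far⇒close {[ r ]} {e} {d} {y} ¬far [ 0≤r ] [ r≤d ] y²≤e = ≤-trans (x²≤y²⇒x≤y 0≤r (begin
    (y + y) * (y + y) ≈⟨ solve 1 (λ y → let z = y :* y in (y :+ y) :* (y :+ y)
        := z :+ (z :+ (z :+ (z :+ con (+ 0))))) ≈-refl y ⟩
    4 · (y * y)       ≤⟨ +-mono-≤ y²≤e (+-mono-≤ y²≤e (+-mono-≤ y²≤e (+-mono-≤ y²≤e ≤-refl))) ⟩
    4 · e             ≤⟨ ≮⇒≥ ¬far ⟩
    r * r             ∎)) r≤d

  -- For j < k, twice the upward deviation at j and twice the downward deviation at k are each at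
  -- most v k - v j; adding the two bounds gives 2 b i j ≤ 2 b i k.
  ¬far⇒consensus : ∀ {m n} {v : Vector Carrier n} (b : Scores m n) → Ordered v →
                   (∀ j → ¬ Far (separation v j) (energy (v j) b j)) → Consensus b
  ¬far⇒consensus {v = v} b v↑ ¬far i j k j≤k with ℕ.m≤n⇒m<n∨m≡n j≤k
  ... | inj₂ j≡k = ≤-reflexive (≈-reflexive (≡.cong (b i) (Fin.toℕ-injective j≡k)))
  ... | inj₁ j<k = *-cancelˡ-≤ 0<1+1 (0≤⇒≤
      (+-nonNegative (≤⇒0≤ (close j (separation≤ˡ v↑ j<k) (≤-refl)))
                     (≤⇒0≤ (close k (separation≤ʳ v↑ j<k) (≤-reflexive negative-square))))
      (solve 4 (λ x y u v → (con (+ 1) :+ con (+ 1)) :* x :+ (v :- u :- ((x :- u) :+ (x :- u)) :+ (v :- u :- (:- (y :- v) :+ :- (y :- v))))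
        := (con (+ 1) :+ con (+ 1)) :* y) ≈-refl (b i j) (b i k) (v j) (v k)))
    where
    close : ∀ l {d y} → separation v l ≤⁺ [ d ] → y * y ≤ (b i l - v l) * (b i l - v l) → y + y ≤ d
    close l sep≤d y²≤ = ¬far⇒close (¬far l) (0≤separation v↑ l) sep≤d
      (≤-trans y²≤ (term≤sum (λ i → 0≤x² (b i l - v l)) i))
    negative-square : (- (b i k - v k)) * (- (b i k - v k)) ≈ (b i k - v k) * (b i k - v k)
    negative-square = solve 1 (λ x → (:- x) :* (:- x) := x :* x) ≈-refl (b i k - v k)

  -- Sums of bounds in [0,∞].

  *⁺-nonPositive : ∀ {x} y → 0# ≤ x → x ≤ 0# → (x *⁺ y) ≤⁺ [ 0# ]
  *⁺-nonPositive {x} [ y ] 0≤x x≤0 = [ ≤-reflexive (≈-trans (*-congʳ (≤-antisym x≤0 0≤x)) (zeroˡ y)) ]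
  *⁺-nonPositive {x} ⊤⁺    0≤x x≤0 with x ≤? 0#
  ... | yes _   = ≤⁺-refl
  ... | no  x≰0 = contradiction x≤0 x≰0

  -- The case where 0 * ∞ = 0 matters: if `x` is 0, an infinite summand still yields the bound 0,
  -- but then `p` and `q` are themselves at most 0.
  +≤*⁺⊤⁺ : ∀ {x p q} y z → 0# ≤ x → [ p ] ≤⁺ (x *⁺ y) → [ q ] ≤⁺ (x *⁺ z) → [ p + q ] ≤⁺ (x *⁺ ⊤⁺)
  +≤*⁺⊤⁺ {x} y z 0≤x p≤xy q≤xz with x ≤? 0#
  ... | no  x≰0 = _ ≤⊤⁺
  ... | yes x≤0 = [ ≤-trans
    (+-mono-≤ ([≤]-injective (≤⁺-trans ≤-trans p≤xy (*⁺-nonPositive y 0≤x x≤0)))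
              ([≤]-injective (≤⁺-trans ≤-trans q≤xz (*⁺-nonPositive z 0≤x x≤0))))
    (≤-reflexive (+-identityˡ 0#)) ]

  +≤*⁺+⁺ : ∀ {x p q} y z → 0# ≤ x → [ p ] ≤⁺ (x *⁺ y) → [ q ] ≤⁺ (x *⁺ z) → [ p + q ] ≤⁺ (x *⁺ (y +⁺ z))
  +≤*⁺+⁺ [ y ]    [ z ]    0≤x [ p≤xy ] [ q≤xz ] = [ ≤-trans (+-mono-≤ p≤xy q≤xz) (≤-reflexive (≈-sym (distribˡ _ y z))) ]
  +≤*⁺+⁺ y@([ _ ]) z@(⊤⁺)  0≤x p≤xy q≤xz = +≤*⁺⊤⁺ y z 0≤x p≤xy q≤xz
  +≤*⁺+⁺ y@(⊤⁺)   z        0≤x p≤xy q≤xz = +≤*⁺⊤⁺ y z 0≤x p≤xy q≤xz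

  sum≤*⁺sum⁺ : ∀ {x n} {p : Vector Carrier n} (q : Vector (Carrier ⁺) n) → 0# ≤ x →
               (∀ j → [ p j ] ≤⁺ (x *⁺ q j)) → [ sum p ] ≤⁺ (x *⁺ sum⁺ q)
  sum≤*⁺sum⁺ {x} {zero}  q 0≤x p≤xq = [ ≤-reflexive (≈-sym (zeroʳ x)) ]
  sum≤*⁺sum⁺ {x} {suc n} q 0≤x p≤xq = +≤*⁺+⁺ (q zero) (sum⁺ (tail q)) 0≤x (p≤xq zero)
    (sum≤*⁺sum⁺ (tail q) 0≤x λ j → p≤xq (suc j))

  n·x≈n·1*x : ∀ n x → n · x ≈ n · 1# * x
  n·x≈n·1*x n x = ≈-trans (×-congʳ n (≈-sym (*-identityˡ x))) (≈-sym (×-assoc-* n 1# x))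

  far⇒≰0 : ∀ {r e} → Far r e → ¬ (e ≤ 0#)
  far⇒≰0 {[ r ]} {e} r²<4e e≤0 = <⇒≱ r²<4e (begin
    4 · e            ≤⟨ +-mono-≤ e≤0 (+-mono-≤ e≤0 (+-mono-≤ e≤0 (+-mono-≤ e≤0 ≤-refl))) ⟩
    4 · 0#           ≈⟨ n·x≈n·1*x 4 0# ⟩
    4 · 1# * 0#      ≈⟨ zeroʳ _ ⟩
    0#               ≤⟨ 0≤x² r ⟩
    r * r            ∎)

  -- Markov's inequality for each object, and the union bound.

  module _ {m n} .{{_ : NonZero m}} (G : Graph m) (P : Fin m → Fin m → Carrier)
    (isDist : IsEdgeDistribution G P) (b : Scores m n) (b̄↑ : Ordered (average b))
    {λ₂} (λ₂-second : IsKthLargestEigenvalue 2 (gossipMatrix G P) λ₂) (t : ℕ) where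

    finalEnergy : Fin n → Vec (Fin m × Fin m) t → Carrier
    finalEnergy j es = energy (average b j) (final G P isDist b es) j

    0≤finalEnergy : ∀ j es → 0# ≤ finalEnergy j es
    0≤finalEnergy j es = 0≤∥∥² (deviation (average b j) (final G P isDist b es) j)

    energyBound : Fin n → Carrier
    energyBound j = λ₂ ^ t * (m · 1# * (spread b j * spread b j))

    0≤λ₂^t : 0# ≤ λ₂ ^ t
    0≤λ₂^t = 0≤^ (0≤λ₂ G P isDist λ₂-second) t

    𝔼-finalEnergy≤ : ∀ j → expectation G P t (finalEnergy j) ≤ energyBound j
    𝔼-finalEnergy≤ j = ≤-trans
      (energy-decay G P isDist λ₂-second t (average b j) b j (sum-deviation-average b j))
      (*-monoˡ-≤ 0≤λ₂^t (energy≤spread² b j))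

    -- The separation is abstracted to `r` so that later proofs can split on whether it is infinite,
    -- zero or neither.
    farProbability : Fin n → Carrier ⁺ → Carrier
    farProbability j r = expectation G P t λ es → indicator (far? r (finalEnergy j es))

    -- `K` stands for 4/r², or for 0 when r is infinite and `Far` is empty.
    farProbability-markov : ∀ j r {K} → 0# ≤ K → (∀ {e} → Far r e → 1# ≤ K * e) →
                            farProbability j r ≤ K * energyBound j
    farProbability-markov j r {K} 0≤K far⇒1≤Ke = begin
      farProbability j r
        ≤⟨ 𝔼-mono G P isDist t (λ es → indicator-mono (far? r (finalEnergy j es))
             (*-nonNegative 0≤K (0≤finalEnergy j es)) far⇒1≤Ke) ⟩
      expectation G P t (λ es → K * finalEnergy j es)
        ≈⟨ 𝔼-scale G P isDist t K (finalEnergy j) ⟩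
      K * expectation G P t (finalEnergy j)
        ≤⟨ *-monoˡ-≤ 0≤K (𝔼-finalEnergy≤ j) ⟩
      K * energyBound j ∎

    -- The substitute for Markov's inequality at r = 0, where being far only says that the energy is
    -- positive and no `K` exists.
    farProbability-vanishes : ∀ j r → energyBound j ≤ 0# → farProbability j r ≤ 0#
    farProbability-vanishes j r bound≤0 = 𝔼≤0 G P isDist t (0≤finalEnergy j)
      (λ es e≤0 → indicator-mono (far? r (finalEnergy j es)) ≤-refl λ far → contradiction e≤0 (far⇒≰0 {r} far))
      (≤-trans (𝔼-finalEnergy≤ j) bound≤0)

    -- Turns a vanishing coefficient 4m λ₂ᵗ, the case 0 * ∞ = 0, into λ₂ᵗ = 0, and shows that the
    -- coefficient is nonnegative.
    λ₂^t≤ : λ₂ ^ t ≤ (4 ℕ.* m) · λ₂ ^ t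
    λ₂^t≤ = begin
      λ₂ ^ t                       ≈⟨ *-identityʳ _ ⟨
      λ₂ ^ t * 1#                  ≤⟨ *-monoˡ-≤ 0≤λ₂^t (1≤n·1 (4 ℕ.* m) {{ℕ.m*n≢0 4 m}}) ⟩
      λ₂ ^ t * (4 ℕ.* m) · 1#      ≈⟨ *-comm _ _ ⟩
      (4 ℕ.* m) · 1# * λ₂ ^ t      ≈⟨ n·x≈n·1*x (4 ℕ.* m) (λ₂ ^ t) ⟨
      (4 ℕ.* m) · λ₂ ^ t           ∎

    farProbability≤ : ∀ j r → [ farProbability j r ] ≤⁺
      (((4 ℕ.* m) · λ₂ ^ t) *⁺ square⁺ (spread b j ÷⁺ r))
    farProbability≤ j ⊤⁺ = [ ≤-trans (farProbability-markov j ⊤⁺ ≤-refl (λ ()))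
      (≤-reflexive (solve 2 (λ e x → con (+ 0) :* e
          := x :* (con (+ 0) :* con (+ 0))) ≈-refl (energyBound j) ((4 ℕ.* m) · λ₂ ^ t))) ]
    farProbability≤ j [ r ] with r ≟ 0#
    ... | no r≉0 = [ ≤-trans (farProbability-markov j [ r ] (0≤· 4 (0≤x² (r ⁻¹))) far⇒1≤Ke) (≤-reflexive (begin-equality
      4 · (r ⁻¹ * r ⁻¹) * energyBound j
        ≈⟨ solve 4 (λ i l n d → let i² = i :* i in
             (i² :+ (i² :+ (i² :+ (i² :+ con (+ 0))))) :* (l :* (n :* (d :* d)))
            
                 := (con (+ 1) :+ (con (+ 1) :+ (con (+ 1) :+ (con (+ 1) :+ con (+ 0))))) :* n :* l :* (d :* i :* (d :* i)))
             ≈-refl (r ⁻¹) (λ₂ ^ t) (m · 1#) d ⟩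
      4 · 1# * m · 1# * λ₂ ^ t * (d * r ⁻¹ * (d * r ⁻¹))
        ≈⟨ *-congʳ (≈-trans (*-congʳ (≈-sym (×1-homo-* 4 m))) (≈-sym (n·x≈n·1*x (4 ℕ.* m) (λ₂ ^ t)))) ⟩
      (4 ℕ.* m) · λ₂ ^ t * (d * r ⁻¹ * (d * r ⁻¹)) ∎)) ]
      where
      d = spread b j
      far⇒1≤Ke : ∀ {e} → r * r < 4 · e → 1# ≤ 4 · (r ⁻¹ * r ⁻¹) * e
      far⇒1≤Ke {e} r²<4e = begin
        1#
          ≈⟨ *-identityˡ 1# ⟨
        1# * 1#
          ≈⟨ *-cong (⁻¹-inverseˡ r≉0) (⁻¹-inverseˡ r≉0) ⟨
        (r ⁻¹ * r) * (r ⁻¹ * r)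
          ≈⟨ solve 2 (λ i r → (i :* r) :* (i :* r) := (i :* i) :* (r :* r)) ≈-refl (r ⁻¹) r ⟩
        (r ⁻¹ * r ⁻¹) * (r * r)
          ≤⟨ *-monoˡ-≤ (0≤x² (r ⁻¹)) (proj₁ r²<4e) ⟩
        (r ⁻¹ * r ⁻¹) * 4 · e
          ≈⟨ ×-comm-* 4 (r ⁻¹ * r ⁻¹) e ⟩
        4 · (r ⁻¹ * r ⁻¹ * e)
          ≈⟨ ×-assoc-* 4 (r ⁻¹ * r ⁻¹) e ⟨
        4 · (r ⁻¹ * r ⁻¹) * e ∎
    ... | yes r≈0 with spread b j ≟ 0#
    -- The term 0 / 0 counts as 0. With no spread, the initial energy is 0, so the probability is 0
    -- too.
    ...   | yes d≈0 = [ ≤-trans (farProbability-vanishes j [ r ] (≤-reflexive (begin-equality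
      λ₂ ^ t * (m · 1# * (spread b j * spread b j)) ≈⟨ *-congˡ (*-congˡ (*-cong d≈0 d≈0)) ⟩
      λ₂ ^ t * (m · 1# * (0# * 0#))
        ≈⟨ solve 2 (λ l n → l :* (n :* (con (+ 0) :* con (+ 0))) := con (+ 0)) ≈-refl (λ₂ ^ t) (m · 1#) ⟩
      0# ∎))) (≤-reflexive (solve 1 (λ x → con (+ 0)
          := x :* (con (+ 0) :* con (+ 0))) ≈-refl ((4 ℕ.* m) · λ₂ ^ t))) ]
    -- The term is ∞, which leaves something to prove only when its coefficient is 0; the expected
    -- energy then has the factor λ₂ᵗ = 0.
    ...   | no _ with (4 ℕ.* m) · λ₂ ^ t ≤? 0#
    ...     | no _    = _ ≤⊤⁺
    ...     | yes x≤0 = [ farProbability-vanishes j [ r ] (≤-reflexive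
      (≈-trans (*-congʳ (≤-antisym (≤-trans λ₂^t≤ x≤0) 0≤λ₂^t)) (zeroˡ _))) ]

    -- Of the event T > t, only the failure of consensus at time t itself is used: some object is
    -- then far, so one of the indicators is 1.
    probability≤sum-farProbability : probability[T> t ] G P b ≤ sum λ j → farProbability j (separation (average b) j)
    probability≤sum-farProbability = ≤-trans
      (𝔼-mono G P isDist t λ es → indicator-mono (T>t? b es) (sum-nonNegative λ j → 0≤indicator (far-at? es j)) (1≤sum es))
      (≤-reflexive (𝔼-sum G P isDist t λ j es → indicator (far-at? es j)))
      where
      far-at? : ∀ es j → Dec (Far (separation (average b) j) (finalEnergy j es))
      far-at? es j = far? (separation (average b) j) (finalEnergy j es)
      1≤sum : ∀ es → T>t b es → 1# ≤ sum λ j → indicator (far-at? es j)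
      1≤sum es T>t with Fin.any? (far-at? es)
      ... | yes (j , far) = ≤-trans (≤-reflexive (≈-sym (indicator-yes (far-at? es j) far)))
                                    (term≤sum (λ j → 0≤indicator (far-at? es j)) j)
      ... | no ∄far = contradiction
        (¬far⇒consensus (final G P isDist b es) b̄↑ λ j far → ∄far (j , far)) (T>t (fromℕ t))

theorem26 : (ℝ : CompleteOrderedField) → let open Gossip ℝ in
    ∀ {m n : ℕ} .{{_ : NonZero m}}
    (G : Graph m) → Graph.Connected G →
    (P : Fin m → Fin m → Carrier) → IsEdgeDistribution G P →
    (b : Scores m n) → Ordered (average b) →
    (λ₂ : Carrier) → IsKthLargestEigenvalue 2 (gossipMatrix G P) λ₂ →
    (t : ℕ) →
    [ probability[T> t ] G P b ] ≤⁺
    (((4 ℕ.* m) · λ₂ ^ t) *⁺ sum⁺ (λ j → square⁺ (spread b j ÷⁺ separation (average b) j)))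
theorem26 ℝ G _ P isDist b b̄↑ λ₂ λ₂-second t = ≤⁺-trans ≤-trans
  [ probability≤sum-farProbability G P isDist b b̄↑ λ₂-second t ]
  (sum≤*⁺sum⁺ (λ j → square⁺ (spread b j ÷⁺ separation (average b) j))
    (≤-trans (0≤λ₂^t G P isDist b b̄↑ λ₂-second t) (λ₂^t≤ G P isDist b b̄↑ λ₂-second t))
    λ j → farProbability≤ G P isDist b b̄↑ λ₂-second t j (separation (average b) j))
  where
  open OrderedField ℝ
  open TailBound ℝ
  open import Relation.Binary.Construct.Add.Supremum.NonStrict _≤_ using (≤⁺-trans; [_])
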